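{- There are graphs with rank-width $k$ and Boolean-width $\Omega(k^2)$ for arbitrarily large $k$. That is, there is a constant $c>0$ such that for every $k_0\in\mathbb{N}$ there exist an integer $k\ge k_0$ and a graph with rank-width $k$ and Boolean-width at least $ck^2$.
   Context: Graphs are finite, simple and undirected. For $X\subseteq V(G)$, $N(X)$ is the set of vertices outside $X$ having a neighbor in $X$. Let $V$ be a finite set with $|V|\ge 3$ and $f$ a function from $2^V$ to the nonnegative reals with $f(\emptyset)=0$ and $f(A)=f(V\setminus A)$ for all $A\subseteq V$. A branch decomposition of $f$ is a tree all of whose internal nodes have degree $3$ and whose leaves are bijectively mapped to $V$. Each edge of the tree corresponds to the bipartition $(A,V\setminus A)$ of $V$ given by the leaves on the two sides of the edge. The width of the decomposition is the maximum of $f(A)$ over bipartitions $(A,V\setminus A)$ corresponding to edges, and the branch-width of $f$ is the minimum width of a branch decomposition of $f$. For disjoint $A,B\subseteq V(G)$, $\mathrm{rw}(A,B)$ is the rank over $\mathbb{F}_2$ of the $|A|\times|B|$ 0-1 adjacency matrix between $A$ and $B$, and $\mathrm{bw}(A,B)=\log_2|\{N(X)\cap B\mid X\subseteq A\}|$. The rank-width of $G$ is the branch-width of $A\mapsto\mathrm{rw}(A,V(G)\setminus A)$, and the Boolean-width of $G$ is the branch-width of $A\mapsto \mathrm{bw}(A,V(G)\setminus A)$. -}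

module Defs where

open import Algebra.Bundles using (CommutativeRing)
open import Data.Bool.Base using (Bool; true; false)
open import Data.Bool.Properties using (xor-∧-commutativeRing)
open import Data.Fin.Base using (Fin; zero; suc)
open import Data.Fin.Properties using (all?; any?)
open import Data.Fin.Subset
  using (Subset; inside; outside; _∈_; _∉_; _⊆_; _∩_; ∁; ∣_∣; Nonempty)
open import Data.Fin.Subset.Properties using (_∈?_; _⊆?_; nonempty?; anySubset?)
open import Data.Integer.Base using (+_; -[1+_])
open import Data.List.Base
  using (List; []; _∷_; _++_; [_]; map; filter; length; deduplicate)
open import Data.List.Extrema.Nat using (max)
open import Data.List.Relation.Unary.Linked using (Linked)
open import Data.List.Relation.Unary.Unique.Propositional using (Unique)
open import Data.Nat.Base as ℕ using (ℕ; suc; _≤_; _*_; _^_)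
open import Data.Product.Base using (Σ-syntax; ∃; ∃-syntax; _×_; _,_)
open import Data.Rational.Unnormalised.Base using (ℚᵘ; mkℚᵘ)
open import Data.Sum.Base using (_⊎_)
open import Data.Vec.Base as Vec using (Vec; []; _∷_; lookup; tabulate)
open import Data.Vec.Properties using (≡-dec)
open import Function.Bundles using (_⇔_; _↔_; Inverse)
open import Relation.Binary.Construct.Closure.ReflexiveTransitive using (Star)
open import Relation.Binary.PropositionalEquality.Core using (_≡_; _≢_)
open import Relation.Nullary using (¬_; Dec; does; ¬?; _×-dec_)
import Algebra.Properties.Monoid.Sum as Sum
import Data.Bool.Properties as Bool

------------------------------------------------------------------------
-- Finite sets

subsets : ∀ n → List (Subset n)
subsets ℕ.zero  = [ [] ]
subsets (suc n) = map (inside ∷_) (subsets n) ++ map (outside ∷_) (subsets n)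

elements : ∀ {n} (A : Subset n) → Vec (Fin n) ∣ A ∣
elements []            = []
elements (inside  ∷ A) = zero ∷ Vec.map suc (elements A)
elements (outside ∷ A) = Vec.map suc (elements A)

------------------------------------------------------------------------
-- Graphs

record Graph (n : ℕ) : Set where
  field
    adj       : Fin n → Fin n → Bool
    symmetric : ∀ u v → adj u v ≡ adj v u
    loopless  : ∀ v → adj v v ≡ false

  Adj : Fin n → Fin n → Set
  Adj u v = adj u v ≡ true

  degree : Fin n → ℕ
  degree v = ∣ tabulate (adj v) ∣

  Leaf : Set
  Leaf = Σ[ t ∈ Fin n ] degree t ≡ 1

  N : Subset n → Subset n
  N X = tabulate λ v →
    does (¬? (v ∈? X) ×-dec any? (λ u → u ∈? X ×-dec adj u v Bool.≟ true))

  Connected : Set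
  Connected = ∀ u v → Star Adj u v

  -- The cycle x, y₁, …, yₘ, x, where m ≥ 2.
  Cycle : Set
  Cycle = ∃[ x ] ∃[ ys ] 2 ≤ length ys × Unique (x ∷ ys) × Linked Adj (x ∷ ys ++ [ x ])

  IsTree : Set
  IsTree = Connected × ¬ Cycle

  AdjWithout : (u v : Fin n) → Fin n → Fin n → Set
  AdjWithout u v a b = Adj a b × ¬ ((a ≡ u × b ≡ v) ⊎ (a ≡ v × b ≡ u))

------------------------------------------------------------------------
-- Branch-width

record BranchDecomposition (n : ℕ) : Set where
  field
    size    : ℕ
    tree    : Graph size
  open Graph tree public
  field
    isTree  : IsTree
    cubic   : ∀ t → degree t ≢ 1 → degree t ≡ 3
    leaves  : Leaf ↔ Fin n

  leafAt : Fin n → Fin size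
  leafAt x = let (t , _) = Inverse.from leaves x in t

  -- A is the side of u in the bipartition given by the edge uv.  The other
  -- side is obtained from the same edge taken as vu.
  Corresponds : (u v : Fin size) → Subset n → Set
  Corresponds u v A = ∀ x → x ∈ A ⇔ Star (AdjWithout u v) u (leafAt x)

  Displayed : Subset n → Set
  Displayed A = ∃[ u ] ∃[ v ] Adj u v × Corresponds u v A

-- The values of f are taken in any type W ordered by _≲_, so that integer
-- valued functions and logarithms of integers are treated alike.
module _ {W : Set} (_≲_ : W → W → Set) {n : ℕ} (f : Subset n → W) where

  IsWidth : BranchDecomposition n → W → Set
  IsWidth D w =
    (∃[ A ] Displayed A × f A ≡ w) × (∀ A → Displayed A → f A ≲ w)
    where open BranchDecomposition D

  IsBranchWidth : W → Set
  IsBranchWidth w =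
    (∃[ D ] IsWidth D w) × (∀ D w′ → IsWidth D w′ → w ≲ w′)

------------------------------------------------------------------------
-- Rank over 𝔽₂

𝔽₂ : CommutativeRing _ _
𝔽₂ = xor-∧-commutativeRing

module 𝔽₂ = CommutativeRing 𝔽₂

Matrix : ℕ → ℕ → Set
Matrix p q = Fin p → Fin q → 𝔽₂.Carrier

open Sum 𝔽₂.+-monoid using (sum)

module _ {p q : ℕ} (M : Matrix p q) where

  -- Coefficient vectors over 𝔽₂ are subsets of the row indices.
  combination : Subset p → Fin q → 𝔽₂.Carrier
  combination c j = sum λ i → lookup c i 𝔽₂.* M i j

  IsDependency : Subset p → Subset p → Set
  IsDependency S c = c ⊆ S × Nonempty c × (∀ j → combination c j ≡ 𝔽₂.0#)

  Independent : Subset p → Set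
  Independent S = ¬ ∃ (IsDependency S)

  independent? : ∀ S → Dec (Independent S)
  independent? S = ¬? (anySubset? λ c →
    c ⊆? S ×-dec nonempty? c ×-dec all? (λ j → combination c j Bool.≟ 𝔽₂.0#))

  rank : ℕ
  rank = max 0 (map ∣_∣ (filter independent? (subsets p)))

------------------------------------------------------------------------
-- Binary logarithms of natural numbers

-- The real number log₂ N, with log₂ 0 = -∞.
record Log₂ : Set where
  constructor log₂
  field argument : ℕ

_≤ˡ_ : Log₂ → Log₂ → Set
log₂ M ≤ˡ log₂ N = M ≤ N

-- a / b ≤ log₂ N if and only if 2 ^ a ≤ N ^ b.
_≤log_ : ℚᵘ → Log₂ → Set
mkℚᵘ (+ a)    b-1 ≤log log₂ N = 2 ^ a ≤ N ^ suc b-1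
mkℚᵘ -[1+ a ] b-1 ≤log log₂ N = 1 ≤ 2 ^ suc a * N ^ suc b-1

------------------------------------------------------------------------
-- Rank-width and Boolean-width

module _ {n : ℕ} (G : Graph n) where
  open Graph G

  adjacencyMatrix : (A B : Subset n) → Matrix ∣ A ∣ ∣ B ∣
  adjacencyMatrix A B i j = adj (lookup (elements A) i) (lookup (elements B) j)

  rw : Subset n → Subset n → ℕ
  rw A B = rank (adjacencyMatrix A B)

  traces : Subset n → Subset n → List (Subset n)
  traces A B = deduplicate (≡-dec Bool._≟_)
    (map (λ X → N X ∩ B) (filter (_⊆? A) (subsets n)))

  bw : Subset n → Subset n → Log₂
  bw A B = log₂ (length (traces A B))

  RankWidth : ℕ → Set
  RankWidth = IsBranchWidth _≤_ (λ A → rw A (∁ A))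

  BooleanWidth : Log₂ → Set
  BooleanWidth = IsBranchWidth _≤ˡ_ (λ A → bw A (∁ A))

module Submission where

-- Take the vertices of G to be the vectors of 𝔽₂ᵐ, two distinct ones being
-- adjacent when their scalar product is 1.  The matrix of every cut factors
-- through 𝔽₂ᵐ, so the rank-width is at most m; it is at least m - 4, as the rows
-- of a balanced cut are combinations of rank many of them and few rows coincide.
--
-- Every branch decomposition displays a balanced cut (A , B).  Choose r vectors
-- of A with orthogonal complement U in 𝔽₂ᵐ; the vertices of B without a
-- neighbour among them form B ∩ U.  Since A has more than a quarter of all
-- vectors, all but one b ∈ B are orthogonal to at least 2ᵐ / 32 vectors of A,
-- and double counting gives about 2 ^ (r m) choices, up to a factor of
-- 2 ^ O(m + r ²), for which B ∩ U has at least T = 2 ^ (m - O(r)) elements.  A set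
-- Z with at least T elements is orthogonal to at most 2ᵐ / T vectors, so it
-- arises from at most (2ᵐ / T) ^ r choices.  With m = 20 r this leaves at least
-- 2 ^ (r ²) different sets B ∩ U, whence the Boolean-width is at least (m / 20) ².
--
-- That the minimum over all decompositions is attained is not obvious
-- constructively.  Rooting a decomposition at the leaf labelled zero yields a
-- binary tree on the other labels, and conversely; there are finitely many of
-- these.

open import Defs
import Algebra.Properties.CommutativeSemigroup
open import Algebra.Properties.Monoid.Sum 𝔽₂.+-monoid using (sum; sum-cong-≗)
open import Data.Bool.Base using (Bool; true; false; _∧_; _∨_; _xor_; not)
open import Data.Bool.ListAction using (all)
open import Data.Bool.Properties as Bool
  using (∧-assoc; ∧-comm; ∧-identityʳ; ∨-comm; not-distribˡ-xor; not-distribʳ-xor; not-involutive;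
         not-injective; ¬-not; xor-same; xor-identityʳ; ∧-distribʳ-xor)
open import Data.Fin.Base using (Fin; zero; suc; _↑ˡ_; _↑ʳ_; splitAt)
open import Data.Fin.Properties as Fin
  using (all?; any?; injective⇒≤; splitAt-↑ˡ; splitAt-↑ʳ; splitAt⁻¹-↑ˡ; splitAt⁻¹-↑ʳ)
open import Data.Fin.Subset as Subset
  using (Subset; _∈_; _∉_; _⊆_; _⊂_; _∪_; _∩_; ∁; ⁅_⁆; ∣_∣; Nonempty)
open import Data.Fin.Subset.Properties
  using (x∈⁅x⁆; x∈⁅y⁆⇒x≡y; ∣⁅x⁆∣≡1; x∈p∪q⁻; x∈p∪q⁺; p⊆p∪q; q⊆p∪q; x∈∁p⇒x∉p; x∉p⇒x∈∁p; ∣∁p∣≡n∸∣p∣;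
         ∉⊥; ∣⊥∣≡0; ∣p∣≤n; p⊂q⇒∣p∣<∣q∣; ⊆-antisym; drop-∷-⊆; _∈?_; _⊆?_; nonempty?; anySubset?)
import Data.Integer.Base as ℤ
import Data.Integer.Properties as ℤ
open import Data.List.Base as List
  using (List; []; _∷_; [_]; _++_; length; map; allFin; filter; cartesianProductWith)
import Data.List.Extrema
open import Data.List.Membership.Propositional using () renaming (_∈_ to _∈ₗ_; _∉_ to _∉ₗ_)
open import Data.List.Membership.Propositional.Properties
  using (∈-map⁺; ∈-map⁻; ∈-++⁺ˡ; ∈-++⁺ʳ; ∈-++⁻; ∈-lookup; ∈-allFin; ∈-cartesianProductWith⁺;
         ∈-filter⁺; ∈-filter⁻; ∈-deduplicate⁺)
open import Data.List.Properties using (length-map; length-tabulate)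
open import Data.List.Relation.Unary.All as All using (All; []; _∷_)
open import Data.List.Relation.Unary.All.Properties using (¬Any⇒All¬)
open import Data.List.Relation.Unary.AllPairs using ([]; _∷_)
open import Data.List.Relation.Unary.Any as Any using (Any; here; there)
open import Data.List.Relation.Unary.Any.Properties using (lookup-index)
open import Data.List.Relation.Unary.Linked using (Linked; [-]; _∷_)
open import Data.List.Relation.Unary.Unique.Propositional using (Unique)
import Data.List.Relation.Unary.Unique.Propositional.Properties as Unique
open import Data.Maybe.Base as Maybe using (Maybe; just; nothing)
open import Data.Maybe.Properties using (just-injective)
open import Data.Nat.Base using (ℕ; zero; suc; _+_; _*_; _∸_; _^_; _≤_; _<_; z≤n; s≤s; NonZero)
open import Data.Nat.Properties
open import Data.Nat.Tactic.RingSolver using (solve-∀)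
open import Data.Product.Base using (Σ-syntax; ∃; ∃-syntax; ∃₂; _×_; _,_; proj₁; proj₂)
open import Data.Rational.Unnormalised.Base as ℚᵘ using (ℚᵘ; mkℚᵘ; 0ℚᵘ; *<*)
open import Data.Sum.Base as Sum using (_⊎_; inj₁; inj₂; [_,_]′)
open import Data.Unit.Base using (⊤; tt)
open import Data.Vec.Base as Vec using (Vec; []; _∷_; tail; zipWith; replicate; lookup; tabulate)
open import Data.Vec.Properties
  using (≡-dec; []=⇒lookup; lookup⇒[]=; lookup-map; lookup-zipWith; lookup∘tabulate; tabulate∘lookup)
open import Function.Base using (_∘_; id; case_of_)
open import Function.Bundles using (_⇔_; mk⇔; Equivalence; Inverse; _↔_; mk↔ₛ′)
open import Relation.Binary.Construct.Closure.ReflexiveTransitive as Star using (Star; ε; _◅_; _◅◅_)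
open import Relation.Binary.PropositionalEquality hiding ([_])
open import Relation.Nullary using (¬_; Dec; yes; no; does; contradiction; ¬?; _×-dec_; _→-dec_)
open import Relation.Nullary.Decidable using (dec-true; dec-false; decidable-stable)
open Algebra.Properties.CommutativeSemigroup 𝔽₂.+-commutativeSemigroup using (interchange)
open Data.List.Extrema ≤-totalOrder
  using (argmin; argmax; argmin-all; argmax-all; argmax-sel; f[argmin]≤f[xs]; f[xs]≤f[argmax];
         f[argmax]≤v⁺; xs≤max)
open Equivalence using (to; from)

-- How the constants arise: for `s` vectors in dimension `m`, the double count over tuples is at
-- least `2 ^ (m - 2 + s (m - 5))`, where 5 is the exponent of the 32. The tuples leaving fewer than
-- `T = 2 ^ (m - 5 s - 3)` elements contribute at most half of it. A larger set is orthogonal to at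
-- most `2 ^ (5 s + 3)` vectors, so the other half forces the logarithm of the number of traces to
-- be at least `s (m - 5 s) - 8 s - 3`. This is quadratic once `m` is a sufficiently large multiple
-- of `s`; for `m = 20 s` it is `15 s² - 8 s - 3`, which is at least `s²` from `s = 1` on. The exact
-- rank-width `k` is never determined: `k ≤ m` turns `s²` into `k² / 400`, and the lower bound on
-- `k` serves to make `k` arbitrarily large. Dimension theory is replaced by a single counting
-- inequality, `translated-orthogonal-bound`. It limits both the vectors orthogonal to a large set
-- and the vectors with equal rows in a cut matrix.

private variable
  m : ℕ

-- Counting in the cube

∑ : ∀ m → (Vec Bool m → ℕ) → ℕ
∑ zero    f = f []
∑ (suc m) f = ∑ m (f ∘ (false ∷_)) + ∑ m (f ∘ (true ∷_))

χ : Bool → ℕ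
χ true  = 1
χ false = 0

# : ∀ {m} → (Vec Bool m → Bool) → ℕ
# {m} P = ∑ m (χ ∘ P)

∑-mono : ∀ {f g : Vec Bool m → ℕ} → (∀ v → f v ≤ g v) → ∑ m f ≤ ∑ m g
∑-mono {zero}  f≤g = f≤g []
∑-mono {suc m} f≤g = +-mono-≤ (∑-mono (f≤g ∘ (false ∷_))) (∑-mono (f≤g ∘ (true ∷_)))

∑-cong : ∀ {f g : Vec Bool m → ℕ} → (∀ v → f v ≡ g v) → ∑ m f ≡ ∑ m g
∑-cong {zero}  f≡g = f≡g []
∑-cong {suc m} f≡g = cong₂ _+_ (∑-cong (f≡g ∘ (false ∷_))) (∑-cong (f≡g ∘ (true ∷_)))

+-interchange : ∀ a b c d → (a + b) + (c + d) ≡ (a + c) + (b + d)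
+-interchange = solve-∀

∑-+ : ∀ (f g : Vec Bool m → ℕ) → ∑ m (λ v → f v + g v) ≡ ∑ m f + ∑ m g
∑-+ {zero}  f g = refl
∑-+ {suc m} f g =
  trans (cong₂ _+_ (∑-+ (f ∘ (false ∷_)) (g ∘ (false ∷_))) (∑-+ (f ∘ (true ∷_)) (g ∘ (true ∷_))))
        (+-interchange (∑ m (f ∘ (false ∷_))) _ _ _)

∑-*ʳ : ∀ (f : Vec Bool m → ℕ) c → ∑ m (λ v → f v * c) ≡ ∑ m f * c
∑-*ʳ {zero}  f c = refl
∑-*ʳ {suc m} f c =
  trans (cong₂ _+_ (∑-*ʳ (f ∘ (false ∷_)) c) (∑-*ʳ (f ∘ (true ∷_)) c)) (sym (*-distribʳ-+ c (∑ m (f ∘ (false ∷_))) _))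

∑-*ˡ : ∀ (f : Vec Bool m → ℕ) c → ∑ m (λ v → c * f v) ≡ c * ∑ m f
∑-*ˡ {m} f c = trans (∑-cong λ v → *-comm c (f v)) (trans (∑-*ʳ f c) (*-comm (∑ m f) c))

2^suc : ∀ m → 2 ^ m + 2 ^ m ≡ 2 ^ suc m
2^suc m = cong (2 ^ m +_) (sym (+-identityʳ _))

∑-const : ∀ m c → ∑ m (λ _ → c) ≡ 2 ^ m * c
∑-const zero    c = sym (+-identityʳ c)
∑-const (suc m) c = begin
  ∑ m (λ _ → c) + ∑ m (λ _ → c)  ≡⟨ cong₂ _+_ (∑-const m c) (∑-const m c) ⟩
  2 ^ m * c + 2 ^ m * c          ≡⟨ *-distribʳ-+ c (2 ^ m) (2 ^ m) ⟨
  (2 ^ m + 2 ^ m) * c            ≡⟨ cong (_* c) (2^suc m) ⟩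
  2 ^ suc m * c                  ∎
  where open ≡-Reasoning

∑-swap : ∀ m n (f : Vec Bool m → Vec Bool n → ℕ) →
         ∑ m (λ v → ∑ n (f v)) ≡ ∑ n (λ w → ∑ m (λ v → f v w))
∑-swap zero    n f = refl
∑-swap (suc m) n f =
  trans (cong₂ _+_ (∑-swap m n (f ∘ (false ∷_))) (∑-swap m n (f ∘ (true ∷_))))
        (sym (∑-+ (λ w → ∑ m λ v → f (false ∷ v) w) _))

∑-∋ : ∀ {f : Vec Bool m → ℕ} v → f v ≤ ∑ m f
∑-∋ []              = ≤-refl
∑-∋ (false ∷ v)     = ≤-trans (∑-∋ v) (m≤m+n _ _)
∑-∋ {suc m} (true ∷ v) = ≤-trans (∑-∋ v) (m≤n+m _ _)

χ≤1 : ∀ b → χ b ≤ 1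
χ≤1 true  = ≤-refl
χ≤1 false = z≤n

χ-∧ : ∀ a b → χ (a ∧ b) ≡ χ a * χ b
χ-∧ true  b = sym (+-identityʳ _)
χ-∧ false b = refl

χ-not : ∀ b → χ b + χ (not b) ≡ 1
χ-not true  = refl
χ-not false = refl

χ-mono : ∀ a b → (a ≡ true → b ≡ true) → χ a ≤ χ b
χ-mono false b a⇒b = z≤n
χ-mono true  b a⇒b rewrite a⇒b refl = ≤-refl

#-mono : ∀ (P Q : Vec Bool m → Bool) → (∀ v → P v ≡ true → Q v ≡ true) → # P ≤ # Q
#-mono P Q P⇒Q = ∑-mono λ v → χ-mono _ _ (P⇒Q v)

#≤2^ : ∀ (P : Vec Bool m → Bool) → # P ≤ 2 ^ m
#≤2^ {m} P = ≤-trans (∑-mono {g = λ _ → 1} λ v → χ≤1 (P v))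
                     (≤-reflexive (trans (∑-const m 1) (*-identityʳ _)))

#-not : ∀ (P : Vec Bool m → Bool) → # P + # (not ∘ P) ≡ 2 ^ m
#-not {m} P = trans (sym (∑-+ (χ ∘ P) (χ ∘ not ∘ P))) (trans (∑-cong (χ-not ∘ P)) (trans (∑-const m 1) (*-identityʳ _)))

∑≡0⊎∃ : ∀ (P : Vec Bool m → Bool) → # P ≡ 0 ⊎ ∃[ v ] P v ≡ true
∑≡0⊎∃ {zero} P with P [] in eq
... | true  = inj₂ ([] , eq)
... | false = inj₁ refl
∑≡0⊎∃ {suc m} P with ∑≡0⊎∃ (P ∘ (false ∷_)) | ∑≡0⊎∃ (P ∘ (true ∷_))
... | inj₂ (v , p) | _            = inj₂ (false ∷ v , p)
... | inj₁ _       | inj₂ (v , p) = inj₂ (true ∷ v , p)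
... | inj₁ p       | inj₁ q       = inj₁ (cong₂ _+_ p q)

#≡0⇒∄ : ∀ {P : Vec Bool m → Bool} → # P ≡ 0 → ∀ v → P v ≢ true
#≡0⇒∄ {P = P} #P≡0 v Pv with ≤-trans (∑-∋ {f = χ ∘ P} v) (≤-reflexive #P≡0)
... | q rewrite Pv = contradiction q λ ()

#≤1 : ∀ (P : Vec Bool m → Bool) → (∀ u v → P u ≡ true → P v ≡ true → u ≡ v) → # P ≤ 1
#≤1 {zero}  P unique = χ≤1 (P [])
#≤1 {suc m} P unique with ∑≡0⊎∃ (P ∘ (false ∷_))
... | inj₁ eq rewrite eq =
  #≤1 (P ∘ (true ∷_)) λ u v Pu Pv → cong tail (unique _ _ Pu Pv)
... | inj₂ (u , Pu) with ∑≡0⊎∃ (P ∘ (true ∷_))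
...   | inj₂ (v , Pv) = contradiction (unique _ _ Pu Pv) λ ()
...   | inj₁ eq rewrite eq = ≤-trans (≤-reflexive (+-identityʳ _))
  (#≤1 (P ∘ (false ∷_)) λ u v Pu Pv → cong tail (unique _ _ Pu Pv))

-- Scalar products over 𝔽₂

dot : Vec Bool m → Vec Bool m → Bool
dot []       []       = false
dot (x ∷ xs) (y ∷ ys) = (x ∧ y) xor dot xs ys

dot-comm : ∀ (u v : Vec Bool m) → dot u v ≡ dot v u
dot-comm []       []       = refl
dot-comm (x ∷ xs) (y ∷ ys) = cong₂ _xor_ (∧-comm x y) (dot-comm xs ys)

dot-false∷ : ∀ b (u v : Vec Bool m) → dot (b ∷ u) (false ∷ v) ≡ dot u v
dot-false∷ true  u v = refl
dot-false∷ false u v = refl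

dot-true∷ : ∀ b (u v : Vec Bool m) → dot (b ∷ u) (true ∷ v) ≡ b xor dot u v
dot-true∷ true  u v = refl
dot-true∷ false u v = refl

xor-cancelˡ : ∀ b {x y} → b xor x ≡ b xor y → x ≡ y
xor-cancelˡ true  {true}  {true}  _ = refl
xor-cancelˡ true  {false} {false} _ = refl
xor-cancelˡ false eq = eq

χ-∨-∧ : ∀ a b → χ a + χ b ≡ χ (a ∨ b) + χ (a ∧ b)
χ-∨-∧ true  b = refl
χ-∨-∧ false b = sym (+-identityʳ _)

∨-elim : ∀ a {b} {C : Set} → (a ≡ true → C) → (b ≡ true → C) → a ∨ b ≡ true → C
∨-elim true  f g _  = f refl
∨-elim false f g eq = g eq

∧-true : ∀ a {b} → a ∧ b ≡ true → a ≡ true × b ≡ true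
∧-true true eq = refl , eq

-- In terms of linear algebra, a translate of `S` lies in the orthogonal complement of the span of
-- `R`, and the two dimensions add up to `m`. Induction on the coordinates avoids spans. Asking for
-- equal products instead of zero ones is what survives the removal of a common leading entry `b`
-- from `S`: a product with `r` changes only by a term determined by `b` and the leading entry of
-- `r`.
translated-orthogonal-bound : ∀ (S R : Vec Bool m → Bool) →
  (∀ s s′ r → S s ≡ true → S s′ ≡ true → R r ≡ true → dot s r ≡ dot s′ r) →
  # S * # R ≤ 2 ^ m
translated-orthogonal-bound {zero} S R const = *-mono-≤ (χ≤1 (S [])) (χ≤1 (R []))
translated-orthogonal-bound {suc m} S R const = conclusion
  where
  open ≤-Reasoning
  S₀ S₁ R₀ R₁ U : Vec Bool m → Bool
  S₀ = S ∘ (false ∷_)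
  S₁ = S ∘ (true ∷_)
  R₀ = R ∘ (false ∷_)
  R₁ = R ∘ (true ∷_)
  U v = R₀ v ∨ R₁ v

  R-split : # R₀ + # R₁ ≡ # U + # (λ v → R₀ v ∧ R₁ v)
  R-split = trans (sym (∑-+ (χ ∘ R₀) (χ ∘ R₁)))
    (trans (∑-cong λ v → χ-∨-∧ (R₀ v) (R₁ v)) (∑-+ (χ ∘ U) λ v → χ (R₀ v ∧ R₁ v)))

  half : ∀ b → # (S ∘ (b ∷_)) * # U ≤ 2 ^ m
  half b = translated-orthogonal-bound (S ∘ (b ∷_)) U λ s s′ r Ss Ss′ → ∨-elim (R₀ r)
    (λ Rr → trans (sym (dot-false∷ b s r)) (trans (const _ _ _ Ss Ss′ Rr) (dot-false∷ b s′ r)))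
    (λ Rr → xor-cancelˡ b (trans (sym (dot-true∷ b s r))
                                 (trans (const _ _ _ Ss Ss′ Rr) (dot-true∷ b s′ r))))

  double : ∀ {s} → s * # U ≤ 2 ^ m → s * (# R₀ + # R₁) ≤ 2 ^ suc m
  double {s} s*U≤ = begin
    s * (# R₀ + # R₁)                  ≡⟨ cong (s *_) R-split ⟩
    s * (# U + # (λ v → R₀ v ∧ R₁ v))  ≤⟨ *-monoʳ-≤ s (+-monoʳ-≤ (# U)
                                           (#-mono _ U λ v RR → ∨-introˡ (proj₁ (∧-true (R₀ v) RR)))) ⟩
    s * (# U + # U)                    ≡⟨ *-distribˡ-+ s (# U) (# U) ⟩
    s * # U + s * # U                  ≤⟨ +-mono-≤ s*U≤ s*U≤ ⟩
    2 ^ m + 2 ^ m                      ≡⟨ 2^suc m ⟩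
    2 ^ suc m                          ∎
    where
    ∨-introˡ : ∀ {a b} → a ≡ true → a ∨ b ≡ true
    ∨-introˡ refl = refl

  conclusion : (# S₀ + # S₁) * (# R₀ + # R₁) ≤ 2 ^ suc m
  conclusion with ∑≡0⊎∃ (λ v → R₀ v ∧ R₁ v)
  -- `R` is then as large as its projection `U`, and each half of `S` obeys the bound in the smaller
  -- cube.
  ... | inj₁ R₀∩R₁≡0 = begin
    (# S₀ + # S₁) * (# R₀ + # R₁)  ≡⟨ cong ((# S₀ + # S₁) *_)
                                       (trans R-split (trans (cong (# U +_) R₀∩R₁≡0) (+-identityʳ _))) ⟩
    (# S₀ + # S₁) * # U            ≡⟨ *-distribʳ-+ (# U) (# S₀) (# S₁) ⟩
    # S₀ * # U + # S₁ * # U        ≤⟨ +-mono-≤ (half false) (half true) ⟩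
    2 ^ m + 2 ^ m                  ≡⟨ 2^suc m ⟩
    2 ^ suc m                      ∎
  -- The two extensions of `r` together distinguish a leading `false` from a leading `true` in `S`.
  -- Hence one half of `S` is empty, which makes up for `R` being up to twice as large as `U`.
  ... | inj₂ (r , RR) with ∧-true (R₀ r) RR | ∑≡0⊎∃ S₀ | ∑≡0⊎∃ S₁
  ...   | _ | inj₁ S₀≡0 | _ rewrite S₀≡0 = double {# S₁} (half true)
  ...   | _ | inj₂ _ | inj₁ S₁≡0 rewrite S₁≡0 | +-identityʳ (# S₀) = double {# S₀} (half false)
  ...   | R₀r , R₁r | inj₂ (s , Ss) | inj₂ (s′ , Ss′) =
    contradiction (trans (sym (const _ _ _ Ss Ss′ R₁r)) (const _ _ _ Ss Ss′ R₀r)) not≢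
    where
    not≢ : not (dot s′ r) ≢ dot s′ r
    not≢ eq with dot s′ r
    not≢ () | true
    not≢ () | false

-- A nonzero `b` gives exactly one half; the inequality also admits the zero vector, for which
-- nothing is counted.
dot-half : ∀ (b : Vec Bool m) → # (λ a → dot a b) * 2 ≤ 2 ^ m
dot-half [] = z≤n
dot-half {suc m} (false ∷ b) = begin
  (# (λ a → dot a b) + # (λ a → dot a b)) * 2  ≡⟨ *-distribʳ-+ 2 (# (λ a → dot a b)) _ ⟩
  _                                            ≤⟨ +-mono-≤ (dot-half b) (dot-half b) ⟩
  2 ^ m + 2 ^ m                                ≡⟨ 2^suc m ⟩
  2 ^ suc m                                    ∎
  where open ≤-Reasoning
dot-half {suc m} (true ∷ b) = begin
  (# (λ a → dot a b) + # (λ a → not (dot a b))) * 2  ≡⟨ cong (_* 2) (#-not (λ a → dot a b)) ⟩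
  2 ^ m * 2                                          ≡⟨ *-comm (2 ^ m) 2 ⟩
  2 ^ suc m                                          ∎
  where open ≤-Reasoning

doubled : ∀ {x y} c → x * c ≤ 2 ^ m → y * c ≤ 2 ^ m → (x + y) * c ≤ 2 ^ suc m
doubled {m} {x} {y} c x≤ y≤ = begin
  (x + y) * c    ≡⟨ *-distribʳ-+ c x y ⟩
  x * c + y * c  ≤⟨ +-mono-≤ x≤ y≤ ⟩
  2 ^ m + 2 ^ m  ≡⟨ 2^suc m ⟩
  2 ^ suc m      ∎
  where open ≤-Reasoning

-- The vectors counted form the hyperplane orthogonal to the nonzero sum of `b` and `b′`. In the
-- induction, equal heads reproduce the agreement of the tails in both halves, and different heads
-- make the two halves complementary.
dots-agree : ∀ {b b′ : Vec Bool m} → b ≢ b′ → # (λ a → not (dot a b xor dot a b′)) * 2 ≤ 2 ^ m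
dots-agree {b = []}    {[]}     b≢b′ = contradiction refl b≢b′
dots-agree {suc m} {x ∷ b} {x′ ∷ b′} b≢b′ = by-heads x x′ b≢b′
  where
  open ≤-Reasoning
  agree disagree : Vec Bool m → Bool
  agree    a = not (dot a b xor dot a b′)
  disagree a = not (not (dot a b) xor dot a b′)

  complementary : (# agree + # disagree) * 2 ≤ 2 ^ suc m
  complementary = begin
    (# agree + # disagree) * 2       ≡⟨ cong (λ z → (# agree + z) * 2)
                                         (∑-cong λ a → cong χ (cong not (sym (not-distribˡ-xor (dot a b) (dot a b′))))) ⟩
    (# agree + # (not ∘ agree)) * 2  ≡⟨ cong (_* 2) (#-not agree) ⟩
    2 ^ m * 2                        ≡⟨ *-comm (2 ^ m) 2 ⟩
    2 ^ suc m                        ∎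

  by-heads : ∀ x x′ → x ∷ b ≢ x′ ∷ b′ → # (λ a → not (dot a (x ∷ b) xor dot a (x′ ∷ b′))) * 2 ≤ 2 ^ suc m
  by-heads false false ≢ = doubled {m} {# agree} 2 (dots-agree (≢ ∘ cong (false ∷_))) (dots-agree (≢ ∘ cong (false ∷_)))
  by-heads true  true  ≢ = begin
    (# agree + # (λ a → not (not (dot a b) xor not (dot a b′)))) * 2
      ≡⟨ cong (λ z → (# agree + z) * 2) (∑-cong λ a → cong (χ ∘ not) (not-xor-not (dot a b) (dot a b′))) ⟩
    (# agree + # agree) * 2
      ≤⟨ doubled {m} {# agree} 2 (dots-agree (≢ ∘ cong (true ∷_))) (dots-agree (≢ ∘ cong (true ∷_))) ⟩
    2 ^ suc m ∎
    where
    not-xor-not : ∀ x y → not x xor not y ≡ x xor y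
    not-xor-not true  y = refl
    not-xor-not false y = not-involutive y
  by-heads true  false _ = begin
    (# agree + # disagree) * 2 ≤⟨ complementary ⟩
    2 ^ suc m ∎
  by-heads false true  _ = begin
    (# agree + # (λ a → not (dot a b xor not (dot a b′)))) * 2
      ≡⟨ cong (λ z → (# agree + z) * 2) (∑-cong λ a → cong (χ ∘ not)
           (trans (sym (not-distribʳ-xor (dot a b) (dot a b′))) (not-distribˡ-xor (dot a b) (dot a b′)))) ⟩
    (# agree + # disagree) * 2 ≤⟨ complementary ⟩
    2 ^ suc m ∎

-- Distinct nonzero vectors over 𝔽₂ are linearly independent, whence the quarter; if one of them is
-- zero, the count is zero.
dots-both-one : ∀ {b b′ : Vec Bool m} → b ≢ b′ → # (λ a → dot a b ∧ dot a b′) * 4 ≤ 2 ^ m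
dots-both-one {b = []}    {[]}     b≢b′ = contradiction refl b≢b′
dots-both-one {suc m} {x ∷ b} {x′ ∷ b′} b≢b′ = by-heads x x′ b≢b′
  where
  open ≤-Reasoning
  both : Vec Bool m → Bool
  both a = dot a b ∧ dot a b′

  twice : ∀ k → k * 2 ≤ 2 ^ m → k * 4 ≤ 2 ^ suc m
  twice k k≤ = begin
    k * 4        ≡⟨ *-assoc k 2 2 ⟨
    k * 2 * 2    ≤⟨ *-monoˡ-≤ 2 k≤ ⟩
    2 ^ m * 2    ≡⟨ *-comm (2 ^ m) 2 ⟩
    2 ^ suc m    ∎

  by-heads : ∀ x x′ → x ∷ b ≢ x′ ∷ b′ → # (λ a → dot a (x ∷ b) ∧ dot a (x′ ∷ b′)) * 4 ≤ 2 ^ suc m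
  by-heads false false ≢ =
    doubled {m} {# both} 4 (dots-both-one (≢ ∘ cong (false ∷_))) (dots-both-one (≢ ∘ cong (false ∷_)))
  by-heads true false _ = begin
    (# both + # (λ a → not (dot a b) ∧ dot a b′)) * 4
      ≡⟨ cong (_* 4) (trans (sym (∑-+ (χ ∘ both) λ a → χ (not (dot a b) ∧ dot a b′))) (∑-cong λ a → split (dot a b) (dot a b′))) ⟩
    # (λ a → dot a b′) * 4  ≤⟨ twice (# λ a → dot a b′) (dot-half b′) ⟩
    2 ^ suc m ∎
    where
    split : ∀ x y → χ (x ∧ y) + χ (not x ∧ y) ≡ χ y
    split true  y = +-identityʳ _
    split false y = refl
  by-heads false true _ = begin
    (# both + # (λ a → dot a b ∧ not (dot a b′))) * 4
      ≡⟨ cong (_* 4) (trans (sym (∑-+ (χ ∘ both) λ a → χ (dot a b ∧ not (dot a b′)))) (∑-cong λ a → split (dot a b) (dot a b′))) ⟩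
    # (λ a → dot a b) * 4  ≤⟨ twice (# λ a → dot a b) (dot-half b) ⟩
    2 ^ suc m ∎
    where
    split : ∀ x y → χ (x ∧ y) + χ (x ∧ not y) ≡ χ x
    split true  y = χ-not y
    split false y = refl
  -- A leading `true` in `a` flips both products, so the two halves together count the `a` on which
  -- the tails agree.
  by-heads true true ≢ = begin
    (# both + # (λ a → not (dot a b) ∧ not (dot a b′))) * 4
      ≡⟨ cong (_* 4) (trans (sym (∑-+ (χ ∘ both) λ a → χ (not (dot a b) ∧ not (dot a b′)))) (∑-cong λ a → split (dot a b) (dot a b′))) ⟩
    # (λ a → not (dot a b xor dot a b′)) * 4  ≤⟨ twice (# λ a → not (dot a b xor dot a b′)) (dots-agree (≢ ∘ cong (true ∷_))) ⟩
    2 ^ suc m ∎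
    where
    split : ∀ x y → χ (x ∧ y) + χ (not x ∧ not y) ≡ χ (not (x xor y))
    split true  y = trans (+-identityʳ _) (cong χ (sym (not-involutive y)))
    split false y = refl

-- Double counting over tuples of vectors

module Tuples {m} (A : Vec Bool m → Bool) where

  -- Ordered tuples with repetitions replace subsets of `A`: their numbers are plain powers, and
  -- each entry can be summed over independently.
  ∑ᴬ : ℕ → (List (Vec Bool m) → ℕ) → ℕ
  ∑ᴬ zero    f = f []
  ∑ᴬ (suc r) f = ∑ m λ a → χ (A a) * ∑ᴬ r (f ∘ (a ∷_))

  AllIn : List (Vec Bool m) → Set
  AllIn = All (λ a → A a ≡ true)

  ∑ᴬ-mono : ∀ r {f g} → (∀ α → AllIn α → f α ≤ g α) → ∑ᴬ r f ≤ ∑ᴬ r g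
  ∑ᴬ-mono zero    f≤g = f≤g [] []
  ∑ᴬ-mono (suc r) {f} {g} f≤g = ∑-mono step
    where
    step : ∀ a → χ (A a) * ∑ᴬ r (f ∘ (a ∷_)) ≤ χ (A a) * ∑ᴬ r (g ∘ (a ∷_))
    step a with A a in eq
    ... | true  = *-monoʳ-≤ 1 (∑ᴬ-mono r λ α α⊆A → f≤g (a ∷ α) (eq ∷ α⊆A))
    ... | false = z≤n

  ∑ᴬ-cong : ∀ r {f g} → (∀ α → f α ≡ g α) → ∑ᴬ r f ≡ ∑ᴬ r g
  ∑ᴬ-cong zero    f≡g = f≡g []
  ∑ᴬ-cong (suc r) f≡g = ∑-cong λ a → cong (χ (A a) *_) (∑ᴬ-cong r (f≡g ∘ (a ∷_)))

  ∑ᴬ-+ : ∀ r {f g} → ∑ᴬ r (λ α → f α + g α) ≡ ∑ᴬ r f + ∑ᴬ r g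
  ∑ᴬ-+ zero    = refl
  ∑ᴬ-+ (suc r) {f} {g} = trans
    (∑-cong λ a → trans (cong (χ (A a) *_) (∑ᴬ-+ r)) (*-distribˡ-+ (χ (A a)) (∑ᴬ r (f ∘ (a ∷_))) _))
    (∑-+ (λ a → χ (A a) * ∑ᴬ r (f ∘ (a ∷_))) _)

  ∑ᴬ-*ˡ : ∀ r c {f} → ∑ᴬ r (λ α → c * f α) ≡ c * ∑ᴬ r f
  ∑ᴬ-*ˡ zero    c = refl
  ∑ᴬ-*ˡ (suc r) c {f} = trans
    (∑-cong λ a → trans (cong (χ (A a) *_) (∑ᴬ-*ˡ r c)) (swap-left (χ (A a)) c (∑ᴬ r (f ∘ (a ∷_)))))
    (∑-*ˡ (λ a → χ (A a) * ∑ᴬ r (f ∘ (a ∷_))) c)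
    where
    swap-left : ∀ x y z → x * (y * z) ≡ y * (x * z)
    swap-left = solve-∀

  ∑ᴬ-const : ∀ r c → ∑ᴬ r (λ _ → c) ≤ (2 ^ m) ^ r * c
  ∑ᴬ-const zero    c = ≤-reflexive (sym (+-identityʳ c))
  ∑ᴬ-const (suc r) c = begin
    ∑ m (λ a → χ (A a) * ∑ᴬ r (λ _ → c))  ≡⟨ ∑-*ʳ (χ ∘ A) (∑ᴬ r (λ _ → c)) ⟩
    # A * ∑ᴬ r (λ _ → c)                  ≤⟨ *-mono-≤ (#≤2^ A) (∑ᴬ-const r c) ⟩
    2 ^ m * ((2 ^ m) ^ r * c)             ≡⟨ *-assoc (2 ^ m) _ c ⟨
    (2 ^ m) ^ suc r * c                   ∎
    where open ≤-Reasoning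

  ∑ᴬ-all : ∀ r R → ∑ᴬ r (χ ∘ all R) ≤ # R ^ r
  ∑ᴬ-all zero    R = ≤-refl
  ∑ᴬ-all (suc r) R = begin
    ∑ m (λ a → χ (A a) * ∑ᴬ r (λ α → χ (R a ∧ all R α)))
      ≤⟨ ∑-mono (λ a → *-monoˡ-≤ _ (χ≤1 (A a))) ⟩
    ∑ m (λ a → 1 * ∑ᴬ r (λ α → χ (R a ∧ all R α)))
      ≡⟨ ∑-cong (λ a → trans (*-identityˡ _) (trans (∑ᴬ-cong r λ α → χ-∧ (R a) (all R α)) (∑ᴬ-*ˡ r (χ (R a))))) ⟩
    ∑ m (λ a → χ (R a) * ∑ᴬ r (χ ∘ all R))
      ≡⟨ ∑-*ʳ (χ ∘ R) (∑ᴬ r (χ ∘ all R)) ⟩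
    # R * ∑ᴬ r (χ ∘ all R)
      ≤⟨ *-monoʳ-≤ (# R) (∑ᴬ-all r R) ⟩
    # R ^ suc r ∎
    where open ≤-Reasoning

  orth : List (Vec Bool m) → Vec Bool m → Bool
  orth α b = all (λ a → not (dot a b)) α

  -- Each `b` is orthogonal to at least `q ^ r` tuples, and the pairs are summed from the side of
  -- the tuples. The induction fixes the first entry `a` and passes to the part of `B` orthogonal to
  -- `a`, whose elements still have `q` orthogonal vectors in `A`; hence `B` varies.
  ∑ᴬ-orth-≥ : ∀ r q (B : Vec Bool m → Bool) →
    (∀ b → B b ≡ true → q ≤ # (λ a → A a ∧ not (dot a b))) →
    # B * q ^ r ≤ ∑ᴬ r (λ α → # (λ b → B b ∧ orth α b))
  ∑ᴬ-orth-≥ zero q B many = begin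
    # B * 1                ≡⟨ *-identityʳ (# B) ⟩
    # B                    ≤⟨ #-mono B _ (λ b Bb → cong (_∧ true) Bb) ⟩
    # (λ b → B b ∧ true)   ∎
    where open ≤-Reasoning
  ∑ᴬ-orth-≥ (suc r) q B many = begin
    # B * (q * q ^ r)
      ≡⟨ *-assoc (# B) q (q ^ r) ⟨
    # B * q * q ^ r
      ≤⟨ *-monoˡ-≤ (q ^ r) incidences ⟩
    ∑ m (λ a → χ (A a) * # (B∩ a)) * q ^ r
      ≡⟨ ∑-*ʳ (λ a → χ (A a) * # (B∩ a)) (q ^ r) ⟨
    ∑ m (λ a → χ (A a) * # (B∩ a) * q ^ r)
      ≤⟨ ∑-mono (λ a → ≤-trans (≤-reflexive (*-assoc (χ (A a)) (# (B∩ a)) (q ^ r))) (*-monoʳ-≤ (χ (A a)) (step a))) ⟩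
    ∑ m (λ a → χ (A a) * ∑ᴬ r (λ α → # (λ b → B b ∧ orth (a ∷ α) b))) ∎
    where
    open ≤-Reasoning
    B∩ : Vec Bool m → Vec Bool m → Bool
    B∩ a b = B b ∧ not (dot a b)

    per-b : ∀ b → χ (B b) * q ≤ ∑ m (λ a → χ (A a) * χ (B∩ a b))
    per-b b with B b in eq
    ... | false = z≤n
    ... | true  = ≤-trans (≤-reflexive (+-identityʳ q)) (≤-trans (many b eq)
                    (≤-reflexive (∑-cong λ a → χ-∧ (A a) (not (dot a b)))))

    incidences : # B * q ≤ ∑ m (λ a → χ (A a) * # (B∩ a))
    incidences = begin
      # B * q                                       ≡⟨ ∑-*ʳ (χ ∘ B) q ⟨
      ∑ m (λ b → χ (B b) * q)                       ≤⟨ ∑-mono per-b ⟩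
      ∑ m (λ b → ∑ m (λ a → χ (A a) * χ (B∩ a b)))  ≡⟨ ∑-swap m m _ ⟩
      ∑ m (λ a → ∑ m (λ b → χ (A a) * χ (B∩ a b)))  ≡⟨ ∑-cong (λ a → ∑-*ˡ (χ ∘ B∩ a) (χ (A a))) ⟩
      ∑ m (λ a → χ (A a) * # (B∩ a))                ∎

    many′ : ∀ a b → B∩ a b ≡ true → q ≤ # (λ a → A a ∧ not (dot a b))
    many′ a b B∩ab = many b (proj₁ (∧-true (B b) B∩ab))

    step : ∀ a → # (B∩ a) * q ^ r ≤ ∑ᴬ r (λ α → # (λ b → B b ∧ orth (a ∷ α) b))
    step a = ≤-trans (∑ᴬ-orth-≥ r q (B∩ a) (many′ a))
      (≤-reflexive (∑ᴬ-cong r λ α → ∑-cong λ b → cong χ (∧-assoc (B b) (not (dot a b)) (orth α b))))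

does-true : ∀ {P : Set} (P? : Dec P) → does P? ≡ true → P
does-true (yes p) _ = p

_⟂ : (Vec Bool m → Bool) → (Vec Bool m → Bool)
(Z ⟂) a = does (# (λ b → Z b ∧ dot a b) ≟ 0)

⟂-intro : ∀ (Z : Vec Bool m → Bool) a → (∀ b → Z b ≡ true → dot a b ≡ false) → (Z ⟂) a ≡ true
⟂-intro Z a orthogonal with ∑≡0⊎∃ (λ b → Z b ∧ dot a b)
... | inj₁ none = dec-true (_ ≟ 0) none
... | inj₂ (b , p) with ∧-true (Z b) p
...   | Zb , ab = contradiction (trans (sym (orthogonal b Zb)) ab) λ ()

⟂-elim : ∀ (Z : Vec Bool m → Bool) a → (Z ⟂) a ≡ true → ∀ b → Z b ≡ true → dot a b ≡ false
⟂-elim Z a a⟂Z b Zb with dot a b in eq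
... | false = refl
... | true  = contradiction (cong₂ _∧_ Zb eq)
  (#≡0⇒∄ (does-true (# (λ b → Z b ∧ dot a b) ≟ 0) a⟂Z) b)

⟂-bound : ∀ (Z : Vec Bool m → Bool) → # Z * # (Z ⟂) ≤ 2 ^ m
⟂-bound Z = translated-orthogonal-bound Z (Z ⟂) λ s s′ r Zs Zs′ Rr →
  trans (vanish s r Zs Rr) (sym (vanish s′ r Zs′ Rr))
  where
  vanish : ∀ s r → Z s ≡ true → (Z ⟂) r ≡ true → dot s r ≡ false
  vanish s r Zs Rr = trans (dot-comm s r) (⟂-elim Z r Rr s Zs)

all-intro : ∀ {A : Set} (p : A → Bool) {xs} → All (λ x → p x ≡ true) xs → all p xs ≡ true
all-intro p []         = refl
all-intro p (px ∷ pxs) = cong₂ _∧_ px (all-intro p pxs)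

all-elim : ∀ {A : Set} (p : A → Bool) xs → all p xs ≡ true → All (λ x → p x ≡ true) xs
all-elim p []       _  = []
all-elim p (x ∷ xs) eq with ∧-true (p x) eq
... | px , pxs = px ∷ all-elim p xs pxs

∑ᴸ : ∀ {A : Set} → (A → ℕ) → List A → ℕ
∑ᴸ f []       = 0
∑ᴸ f (x ∷ xs) = f x + ∑ᴸ f xs

∑ᴸ-Any : ∀ {A : Set} {P : A → Set} {f xs c} → (∀ x → P x → c ≤ f x) → Any P xs → c ≤ ∑ᴸ f xs
∑ᴸ-Any h (here px)   = ≤-trans (h _ px) (m≤m+n _ _)
∑ᴸ-Any h (there pxs) = ≤-trans (∑ᴸ-Any h pxs) (m≤n+m _ _)

-- Bounding the tuples that leave a large common set

module TraceCount {m} (A B : Vec Bool m → Bool) where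
  open Tuples A

  Represents : List (Vec Bool m) → (Vec Bool m → Bool) → Set
  Represents α Z = ∀ b → Z b ≡ B b ∧ orth α b

  module _ (L : List (Vec Bool m → Bool)) (represented : ∀ α → AllIn α → Any (Represents α) L)
           (T Q : ℕ) .{{_ : NonZero T}} (T*Q : T * Q ≡ 2 ^ m) where

    -- Indicates that `Z` is large and that `α` is orthogonal to it. For large `Z` this is weaker
    -- than `Represents α Z`, so a tuple may be counted for several `Z`, but the tuples of a given
    -- `Z` are now just the tuples over `Z ⟂`.
    weight : List (Vec Bool m) → (Vec Bool m → Bool) → ℕ
    weight α Z = χ (does (T ≤? # Z)) * χ (all (Z ⟂) α)

    ∑ᴬ-weight : ∀ r Z → ∑ᴬ r (λ α → weight α Z) ≤ Q ^ r
    ∑ᴬ-weight r Z = by-size (does (T ≤? # Z)) (does-true (T ≤? # Z))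
      where
      open ≤-Reasoning
      #Z⟂≤Q : T ≤ # Z → # (Z ⟂) ≤ Q
      #Z⟂≤Q T≤ = *-cancelˡ-≤ T (≤-trans (*-monoˡ-≤ (# (Z ⟂)) T≤)
                (≤-trans (⟂-bound Z) (≤-reflexive (sym T*Q))))

      by-size : ∀ t → (t ≡ true → T ≤ # Z) → ∑ᴬ r (λ α → χ t * χ (all (Z ⟂) α)) ≤ Q ^ r
      by-size false _  = ≤-trans (≤-reflexive (∑ᴬ-*ˡ r 0 {λ α → χ (all (Z ⟂) α)})) z≤n
      by-size true  T≤ = begin
        ∑ᴬ r (λ α → 1 * χ (all (Z ⟂) α))  ≡⟨ ∑ᴬ-cong r (λ α → *-identityˡ _) ⟩
        ∑ᴬ r (λ α → χ (all (Z ⟂) α))      ≤⟨ ∑ᴬ-all r (Z ⟂) ⟩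
        # (Z ⟂) ^ r                       ≤⟨ ^-monoˡ-≤ r (#Z⟂≤Q (T≤ refl)) ⟩
        Q ^ r                             ∎

    ∑ᴬ-weights : ∀ r Zs → ∑ᴬ r (λ α → ∑ᴸ (weight α) Zs) ≤ length Zs * Q ^ r
    ∑ᴬ-weights r []       = ≤-trans (∑ᴬ-const r 0) (≤-reflexive (*-zeroʳ ((2 ^ m) ^ r)))
    ∑ᴬ-weights r (Z ∷ Zs) = ≤-trans (≤-reflexive (∑ᴬ-+ r)) (+-mono-≤ (∑ᴬ-weight r Z) (∑ᴬ-weights r Zs))

    -- A small set contributes less than `T`. A large one is represented by some listed `Z` of
    -- weight 1 and is bounded by the whole cube; the factor `2 ^ m` lost in this way is harmless
    -- beside the `r`-th powers.
    orth-≤-weights : ∀ α → AllIn α → # (λ b → B b ∧ orth α b) ≤ T + 2 ^ m * ∑ᴸ (weight α) L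
    orth-≤-weights α α⊆A with T ≤? # (λ b → B b ∧ orth α b)
    ... | no  T≰ = ≤-trans (<⇒≤ (≰⇒> T≰)) (m≤m+n T _)
    ... | yes T≤ = ≤-trans (≤-trans (#≤2^ {m} _) (≤-trans (≤-reflexive (sym (*-identityʳ _)))
                     (*-monoʳ-≤ (2 ^ m) (∑ᴸ-Any weight≥1 (represented α α⊆A))))) (m≤n+m _ T)
      where
      weight≥1 : ∀ Z → Represents α Z → 1 ≤ weight α Z
      weight≥1 Z rep = ≤-reflexive (sym (cong₂ (λ x y → χ x * χ y)
        (dec-true (T ≤? # Z) (≤-trans T≤ (≤-reflexive (∑-cong λ b → cong χ (sym (rep b))))))
        (all-intro (Z ⟂) (All.tabulate λ {a} a∈α → ⟂-intro Z a λ b Zb → not-injective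
          (All.lookup (all-elim _ α (proj₂ (∧-true (B b) (trans (sym (rep b)) Zb)))) a∈α)))))

    ∑ᴬ-orth-≤ : ∀ r → ∑ᴬ r (λ α → # (λ b → B b ∧ orth α b)) ≤
                (2 ^ m) ^ r * T + 2 ^ m * (length L * Q ^ r)
    ∑ᴬ-orth-≤ r = begin
      ∑ᴬ r (λ α → # (λ b → B b ∧ orth α b))
        ≤⟨ ∑ᴬ-mono r orth-≤-weights ⟩
      ∑ᴬ r (λ α → T + 2 ^ m * ∑ᴸ (weight α) L)
        ≡⟨ ∑ᴬ-+ r ⟩
      ∑ᴬ r (λ _ → T) + ∑ᴬ r (λ α → 2 ^ m * ∑ᴸ (weight α) L)
        ≡⟨ cong (∑ᴬ r (λ _ → T) +_) (∑ᴬ-*ˡ r (2 ^ m)) ⟩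
      ∑ᴬ r (λ _ → T) + 2 ^ m * ∑ᴬ r (λ α → ∑ᴸ (weight α) L)
        ≤⟨ +-mono-≤ (∑ᴬ-const r T) (*-monoʳ-≤ (2 ^ m) (∑ᴬ-weights r L)) ⟩
      (2 ^ m) ^ r * T + 2 ^ m * (length L * Q ^ r) ∎
      where open ≤-Reasoning

-- Two poor vectors b ≢ b′ would leave A little more than the quarter of all
-- vectors whose scalar products with b and b′ are both 1.
module Rich {m} (A B : Vec Bool (m + 5) → Bool) where

  q : ℕ
  q = 2 ^ m

  #⊥ : Vec Bool (m + 5) → ℕ
  #⊥ b = # (λ a → A a ∧ not (dot a b))

  rich poor : Vec Bool (m + 5) → Bool
  rich b = B b ∧ does (q ≤? #⊥ b)
  poor b = B b ∧ not (does (q ≤? #⊥ b))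

  rich⇒≥q : ∀ b → rich b ≡ true → q ≤ #⊥ b
  rich⇒≥q b p = does-true (q ≤? #⊥ b) (proj₂ (∧-true (B b) p))

  poor⇒<q : ∀ b → poor b ≡ true → #⊥ b < q
  poor⇒<q b p = ≰⇒> λ q≤ → contradiction
    (trans (sym (proj₂ (∧-true (B b) p))) (cong not (dec-true (q ≤? #⊥ b) q≤))) λ ()

  module _ (A-large : 2 ^ (m + 5) ≤ 3 * # A) where

    poor-unique : ∀ b b′ → poor b ≡ true → poor b′ ≡ true → b ≡ b′
    poor-unique b b′ p p′ with ≡-dec Bool._≟_ b b′
    ... | yes b≡b′ = b≡b′
    ... | no  b≢b′ = contradiction too-large (<⇒≱ too-small)
      where
      open ≤-Reasoning
      both : Vec Bool (m + 5) → Bool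
      both a = dot a b ∧ dot a b′

      pointwise : ∀ a → χ (A a) ≤ χ (A a ∧ not (dot a b)) + χ (A a ∧ not (dot a b′)) + χ (both a)
      pointwise a with A a | dot a b | dot a b′
      ... | false | _     | _     = z≤n
      ... | true  | false | _     = s≤s z≤n
      ... | true  | true  | false = s≤s z≤n
      ... | true  | true  | true  = s≤s z≤n

      A-bound : # A ≤ #⊥ b + #⊥ b′ + # both
      A-bound = begin
        # A
          ≤⟨ ∑-mono pointwise ⟩
        ∑ (m + 5) (λ a → χ (A a ∧ not (dot a b)) + χ (A a ∧ not (dot a b′)) + χ (both a))
          ≡⟨ ∑-+ (λ a → χ (A a ∧ not (dot a b)) + χ (A a ∧ not (dot a b′))) (χ ∘ both) ⟩
        ∑ (m + 5) (λ a → χ (A a ∧ not (dot a b)) + χ (A a ∧ not (dot a b′))) + # both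
          ≡⟨ cong (_+ # both) (∑-+ (λ a → χ (A a ∧ not (dot a b))) _) ⟩
        #⊥ b + #⊥ b′ + # both ∎

      2^m+5 : 2 ^ (m + 5) ≡ 32 * q
      2^m+5 = trans (^-distribˡ-+-* 2 m 5) (*-comm q 32)

      both≤ : # both ≤ 8 * q
      both≤ = *-cancelʳ-≤ (# both) (8 * q) 4 (begin
        # both * 4   ≤⟨ dots-both-one b≢b′ ⟩
        2 ^ (m + 5)  ≡⟨ trans 2^m+5 (regroup q) ⟩
        8 * q * 4    ∎)
        where
        regroup : ∀ q → 32 * q ≡ 8 * q * 4
        regroup = solve-∀

      -- In units of `q`, the set `A` has size at least 32 / 3, but the two sets orthogonal to poor
      -- vectors and the common part account for less than 1 + 1 + 8.
      too-small : 3 * # A < 32 * q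
      too-small = begin-strict
        3 * # A                  ≤⟨ *-monoʳ-≤ 3 A-bound ⟩
        3 * (#⊥ b + #⊥ b′ + # both) <⟨ *-monoʳ-< 3 (+-mono-<-≤ (+-mono-< (poor⇒<q b p) (poor⇒<q b′ p′)) both≤) ⟩
        3 * (q + q + 8 * q)      ≡⟨ regroup q ⟩
        30 * q                   ≤⟨ *-monoˡ-≤ q (m≤m+n 30 2) ⟩
        32 * q                   ∎
        where
        regroup : ∀ q → 3 * (q + q + 8 * q) ≡ 30 * q
        regroup = solve-∀

      too-large : 32 * q ≤ 3 * # A
      too-large = ≤-trans (≤-reflexive (sym 2^m+5)) A-large

    -- `B` has at least `32 q / 3` elements and loses at most one of them; the power of two `8 q`
    -- leaves room for that loss.
    rich-large : 2 ^ (m + 5) ≤ 3 * # B → 2 ^ (m + 3) ≤ # rich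
    rich-large B-large = *-cancelˡ-≤ 12 (+-cancelʳ-≤ 12 _ _ (begin
      12 * 2 ^ (m + 3) + 12        ≤⟨ +-mono-≤ (≤-reflexive twelve) (m≤m+n 12 20) ⟩
      96 * 2 ^ m + 32 * 1          ≤⟨ +-monoʳ-≤ (96 * 2 ^ m) (*-monoʳ-≤ 32 (m^n>0 2 m)) ⟩
      96 * 2 ^ m + 32 * 2 ^ m      ≡⟨ regroup (2 ^ m) ⟩
      4 * (32 * 2 ^ m)             ≡⟨ cong (4 *_) (trans (^-distribˡ-+-* 2 m 5) (*-comm (2 ^ m) 32)) ⟨
      4 * 2 ^ (m + 5)              ≤⟨ *-monoʳ-≤ 4 B-large ⟩
      4 * (3 * # B)                ≤⟨ *-monoʳ-≤ 4 (*-monoʳ-≤ 3 B-bound) ⟩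
      4 * (3 * (# rich + 1))       ≡⟨ regroup′ (# rich) ⟩
      12 * # rich + 12             ∎))
      where
      open ≤-Reasoning
      twelve : 12 * 2 ^ (m + 3) ≡ 96 * 2 ^ m
      twelve = trans (cong (12 *_) (trans (^-distribˡ-+-* 2 m 3) (*-comm (2 ^ m) 8))) (sym (*-assoc 12 8 (2 ^ m)))
      regroup : ∀ q → 96 * q + 32 * q ≡ 4 * (32 * q)
      regroup = solve-∀
      regroup′ : ∀ x → 4 * (3 * (x + 1)) ≡ 12 * x + 12
      regroup′ = solve-∀
      split : ∀ b → χ (B b) ≡ χ (rich b) + χ (poor b)
      split b with B b
      ... | false = refl
      ... | true  = sym (χ-not (does (q ≤? #⊥ b)))
      B-bound : # B ≤ # rich + 1
      B-bound = begin
        # B               ≡⟨ trans (∑-cong split) (∑-+ (χ ∘ rich) (χ ∘ poor)) ⟩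
        # rich + # poor   ≤⟨ +-monoʳ-≤ (# rich) (#≤1 poor poor-unique) ⟩
        # rich + 1        ∎

-- 20 (r + 1), written so that 2 ^ dim r does not unfold into a sum.
dim : ℕ → ℕ
dim r = 20 * r + 15 + 5

many-traces : ∀ r (A B : Vec Bool (dim r) → Bool) L →
  2 ^ dim r ≤ 3 * # A → 2 ^ dim r ≤ 3 * # B →
  (∀ α → Tuples.AllIn A α → Any (TraceCount.Represents A B α) L) →
  2 ^ (suc r * suc r) ≤ length L
many-traces r A B L A-large B-large represented = ≮⇒≥ λ few → contradiction lower-bound (<⇒≱ (upper-bound few))
  where
  open ≤-Reasoning
  open Tuples A
  open Rich A B using (rich; rich⇒≥q; rich-large)

  -- With `s = r + 1` these are `2 ^ (m - 5 s - 3)` and `2 ^ (5 s + 3)`. The choice of `T` makes the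
  -- small sets account for exactly half of the lower bound: `counted` reads
  -- `2 ^ suc E ≤ 2 ^ E + …`.
  T Q : ℕ
  T = 2 ^ (15 * r + 12)
  Q = 2 ^ (5 * r + 8)

  instance
    T≢0 : NonZero T
    T≢0 = m^n≢0 2 (15 * r + 12)

  ^-+ : ∀ a b → 2 ^ a * 2 ^ b ≡ 2 ^ (a + b)
  ^-+ a b = sym (^-distribˡ-+-* 2 a b)

  T*Q : T * Q ≡ 2 ^ dim r
  T*Q = trans (^-+ (15 * r + 12) (5 * r + 8)) (cong (2 ^_) (exponents r))
    where
    exponents : ∀ r → 15 * r + 12 + (5 * r + 8) ≡ 20 * r + 15 + 5
    exponents = solve-∀

  E : ℕ
  E = 20 * r * r + 55 * r + 32

  counted : 2 ^ (20 * r + 15 + 3) * (2 ^ (20 * r + 15)) ^ suc r ≤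
            (2 ^ dim r) ^ suc r * T + 2 ^ dim r * (length L * Q ^ suc r)
  counted = begin
    2 ^ (20 * r + 15 + 3) * (2 ^ (20 * r + 15)) ^ suc r
      ≤⟨ *-monoˡ-≤ _ (rich-large A-large B-large) ⟩
    # rich * (2 ^ (20 * r + 15)) ^ suc r
      ≤⟨ ∑ᴬ-orth-≥ (suc r) (2 ^ (20 * r + 15)) rich rich⇒≥q ⟩
    ∑ᴬ (suc r) (λ α → # (λ b → rich b ∧ orth α b))
      ≤⟨ ∑ᴬ-mono (suc r) (λ α _ → #-mono (λ b → rich b ∧ orth α b) _ λ b p →
           cong₂ _∧_ (proj₁ (∧-true (B b) (proj₁ (∧-true (rich b) p)))) (proj₂ (∧-true (rich b) {orth α b} p))) ⟩
    ∑ᴬ (suc r) (λ α → # (λ b → B b ∧ orth α b))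
      ≤⟨ TraceCount.∑ᴬ-orth-≤ A B L represented T Q T*Q (suc r) ⟩
    (2 ^ dim r) ^ suc r * T + 2 ^ dim r * (length L * Q ^ suc r) ∎

  lower-bound : 2 ^ E ≤ 2 ^ dim r * (length L * Q ^ suc r)
  lower-bound = +-cancelˡ-≤ (2 ^ E) _ _ (begin
    2 ^ E + 2 ^ E
      ≡⟨ trans (2^suc E) (cong (2 ^_) (exponents r)) ⟩
    2 ^ (20 * r + 15 + 3 + (20 * r + 15) * suc r)
      ≡⟨ trans (cong (2 ^ (20 * r + 15 + 3) *_) (^-*-assoc 2 (20 * r + 15) (suc r))) (^-+ (20 * r + 15 + 3) _) ⟨
    2 ^ (20 * r + 15 + 3) * (2 ^ (20 * r + 15)) ^ suc r
      ≤⟨ counted ⟩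
    (2 ^ dim r) ^ suc r * T + 2 ^ dim r * (length L * Q ^ suc r)
      ≡⟨ cong (_+ 2 ^ dim r * (length L * Q ^ suc r)) (trans (cong (_* T) (^-*-assoc 2 (dim r) (suc r)))
           (trans (^-+ (dim r * suc r) _) (cong (2 ^_) (exponents′ r)))) ⟩
    2 ^ E + 2 ^ dim r * (length L * Q ^ suc r) ∎)
    where
    exponents : ∀ r → suc (20 * r * r + 55 * r + 32) ≡ 20 * r + 15 + 3 + (20 * r + 15) * suc r
    exponents = solve-∀
    exponents′ : ∀ r → (20 * r + 15 + 5) * suc r + (15 * r + 12) ≡ 20 * r * r + 55 * r + 32
    exponents′ = solve-∀

  upper-bound : length L < 2 ^ (suc r * suc r) → 2 ^ dim r * (length L * Q ^ suc r) < 2 ^ E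
  upper-bound few = begin-strict
    2 ^ dim r * (length L * Q ^ suc r)
      ≡⟨ cong (λ x → 2 ^ dim r * (length L * x)) (^-*-assoc 2 (5 * r + 8) (suc r)) ⟩
    2 ^ dim r * (length L * 2 ^ ((5 * r + 8) * suc r))
      <⟨ *-monoʳ-< (2 ^ dim r) {{m^n≢0 2 (dim r)}} (*-monoˡ-< (2 ^ ((5 * r + 8) * suc r)) {{m^n≢0 2 ((5 * r + 8) * suc r)}} few) ⟩
    2 ^ dim r * (2 ^ (suc r * suc r) * 2 ^ ((5 * r + 8) * suc r))
      ≡⟨ trans (cong (2 ^ dim r *_) (^-+ (suc r * suc r) _)) (^-+ (dim r) _) ⟩
    2 ^ (dim r + (suc r * suc r + (5 * r + 8) * suc r))
      -- The added polynomial is the slack `14 s² - 8 s - 3` for `s = r + 1`.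
      ≤⟨ ^-monoʳ-≤ 2 (≤-trans (m≤m+n (dim r + (suc r * suc r + (5 * r + 8) * suc r)) (14 * r * r + 20 * r + 3)) (≤-reflexive (exponents r))) ⟩
    2 ^ E ∎
    where
    exponents : ∀ r → 20 * r + 15 + 5 + (suc r * suc r + (5 * r + 8) * suc r) + (14 * r * r + 20 * r + 3) ≡
                20 * r * r + 55 * r + 32
    exponents = solve-∀

-- Rank over 𝔽₂

private variable
  p q : ℕ

-- The fibres of `f` over the `2 ^ m` possible values cover `P`, and each of them has at most one
-- element in `P`.
#≤2^-injective : ∀ (P : Vec Bool p → Bool) (f : Vec Bool p → Vec Bool m) →
  (∀ c d → P c ≡ true → P d ≡ true → f c ≡ f d → c ≡ d) → # P ≤ 2 ^ m
#≤2^-injective {p} {m} P f injective = begin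
  ∑ p (λ c → χ (P c))
    ≤⟨ ∑-mono (λ c → ≤-trans (χ-mono (P c) (hits (f c) c) λ Pc → cong₂ _∧_ Pc (dec-true (f c ≟ⱽ f c) refl))
                             (∑-∋ {f = λ v → χ (hits v c)} (f c))) ⟩
  ∑ p (λ c → ∑ m (λ v → χ (hits v c)))
    ≡⟨ ∑-swap p m _ ⟩
  ∑ m (λ v → # (hits v))
    ≤⟨ ∑-mono {g = λ _ → 1} (λ v → #≤1 (hits v) (unique v)) ⟩
  ∑ m (λ _ → 1)
    ≡⟨ trans (∑-const m 1) (*-identityʳ _) ⟩
  2 ^ m ∎
  where
  open ≤-Reasoning
  _≟ⱽ_ : ∀ {m} (u v : Vec Bool m) → Dec (u ≡ v)
  _≟ⱽ_ = ≡-dec Bool._≟_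
  hits : Vec Bool m → Vec Bool p → Bool
  hits v c = P c ∧ does (f c ≟ⱽ v)
  unique : ∀ v c d → hits v c ≡ true → hits v d ≡ true → c ≡ d
  unique v c d hc hd with ∧-true (P c) hc | ∧-true (P d) hd
  ... | Pc , fc≡v | Pd , fd≡v =
    injective c d Pc Pd (trans (does-true (f c ≟ⱽ v) fc≡v) (sym (does-true (f d ≟ⱽ v) fd≡v)))

-- A Boolean inclusion, so that the coefficient vectors supported in `S` can be counted by `#`.
_⊆ᵇ_ : Subset p → Subset p → Bool
[]      ⊆ᵇ []      = true
(x ∷ c) ⊆ᵇ (s ∷ S) = (not x ∨ s) ∧ (c ⊆ᵇ S)

⊆ᵇ⇒⊆ : ∀ (c S : Subset p) → c ⊆ᵇ S ≡ true → c ⊆ S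
⊆ᵇ⇒⊆ (true ∷ c) (true ∷ S) eq Vec.here       = Vec.here
⊆ᵇ⇒⊆ (x ∷ c)    (s ∷ S)    eq (Vec.there x∈) = Vec.there (⊆ᵇ⇒⊆ c S (proj₂ (∧-true (not x ∨ s) eq)) x∈)

⊆⇒⊆ᵇ : ∀ (c S : Subset p) → c ⊆ S → c ⊆ᵇ S ≡ true
⊆⇒⊆ᵇ []          []          _   = refl
⊆⇒⊆ᵇ (false ∷ c) (s ∷ S)     c⊆S = ⊆⇒⊆ᵇ c S (drop-∷-⊆ c⊆S)
⊆⇒⊆ᵇ (true ∷ c)  (true ∷ S)  c⊆S = ⊆⇒⊆ᵇ c S (drop-∷-⊆ c⊆S)
⊆⇒⊆ᵇ (true ∷ c)  (false ∷ S) c⊆S = contradiction (c⊆S Vec.here) λ ()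

#⊆ : ∀ (S : Subset p) → # (_⊆ᵇ S) ≡ 2 ^ ∣ S ∣
#⊆ []          = refl
#⊆ (true ∷ S)  = trans (cong₂ _+_ (#⊆ S) (#⊆ S)) (2^suc ∣ S ∣)
#⊆ {suc p} (false ∷ S) = trans (cong₂ _+_ (#⊆ S) (trans (∑-const p 0) (*-zeroʳ (2 ^ p)))) (+-identityʳ _)

infixl 6 _⊕_
_⊕_ : Vec Bool m → Vec Bool m → Vec Bool m
_⊕_ = zipWith _xor_

dot-⊕ : ∀ (u v w : Vec Bool m) → dot (u ⊕ v) w ≡ dot u w xor dot v w
dot-⊕ []      []      []      = refl
dot-⊕ (x ∷ u) (y ∷ v) (z ∷ w) = begin
  ((x xor y) ∧ z) xor dot (u ⊕ v) w                ≡⟨ cong₂ _xor_ (∧-distribʳ-xor z x y) (dot-⊕ u v w) ⟩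
  ((x ∧ z) xor (y ∧ z)) xor (dot u w xor dot v w)  ≡⟨ interchange (x ∧ z) (y ∧ z) (dot u w) (dot v w) ⟩
  ((x ∧ z) xor dot u w) xor ((y ∧ z) xor dot v w)  ∎
  where
  open ≡-Reasoning

dot-zero : ∀ (w : Vec Bool m) → dot (replicate m false) w ≡ false
dot-zero []      = refl
dot-zero (z ∷ w) = dot-zero w

⊕-≡ : ∀ {u v : Vec Bool m} → (∀ i → lookup (u ⊕ v) i ≡ false) → u ≡ v
⊕-≡ {u = []}    {[]}    _    = refl
⊕-≡ {u = x ∷ u} {y ∷ v} none = cong₂ _∷_ (xor-false x y (none zero)) (⊕-≡ (none ∘ suc))
  where
  xor-false : ∀ x y → x xor y ≡ false → x ≡ y
  xor-false true  true  _ = refl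
  xor-false false y     eq = sym eq

-- `combination M c j` unfolds to `pairing c (λ i → M i j)`, so linearity in `c` is available for
-- all columns at once.
pairing : Vec Bool p → (Fin p → Bool) → Bool
pairing c t = sum λ i → lookup c i ∧ t i

pairing-⊕ : ∀ (c d : Vec Bool p) t → pairing (c ⊕ d) t ≡ pairing c t xor pairing d t
pairing-⊕ []      []      t = refl
pairing-⊕ (x ∷ c) (y ∷ d) t = begin
  ((x xor y) ∧ t zero) xor pairing (c ⊕ d) (t ∘ suc)
    ≡⟨ cong₂ _xor_ (∧-distribʳ-xor (t zero) x y) (pairing-⊕ c d (t ∘ suc)) ⟩
  ((x ∧ t zero) xor (y ∧ t zero)) xor (pairing c (t ∘ suc) xor pairing d (t ∘ suc))
    ≡⟨ interchange (x ∧ t zero) (y ∧ t zero) _ _ ⟩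
  pairing (x ∷ c) t xor pairing (y ∷ d) t ∎
  where
  open ≡-Reasoning

pairing-⊥ : ∀ (t : Fin p → Bool) → pairing Subset.⊥ t ≡ false
pairing-⊥ {zero}  t = refl
pairing-⊥ {suc p} t = pairing-⊥ (t ∘ suc)

pairing-⁅⁆ : ∀ (i : Fin p) t → pairing ⁅ i ⁆ t ≡ t i
pairing-⁅⁆ zero    t = trans (cong (t zero xor_) (pairing-⊥ (t ∘ suc))) (xor-identityʳ (t zero))
pairing-⁅⁆ (suc i) t = pairing-⁅⁆ i (t ∘ suc)

superpose : Vec Bool p → (Fin p → Vec Bool m) → Vec Bool m
superpose         []          a = replicate _ false
superpose         (true ∷ c)  a = a zero ⊕ superpose c (a ∘ suc)
superpose         (false ∷ c) a = superpose c (a ∘ suc)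

dot-superpose : ∀ (c : Vec Bool p) (a : Fin p → Vec Bool m) w →
                dot (superpose c a) w ≡ pairing c (λ i → dot (a i) w)
dot-superpose []          a w = dot-zero w
dot-superpose (true ∷ c)  a w = trans (dot-⊕ (a zero) _ w) (cong (dot (a zero) w xor_) (dot-superpose c (a ∘ suc) w))
dot-superpose (false ∷ c) a w = dot-superpose c (a ∘ suc) w

∈-subsets : ∀ {n} (S : Subset n) → S ∈ₗ subsets n
∈-subsets []          = here refl
∈-subsets (true ∷ S)  = ∈-++⁺ˡ (∈-map⁺ (true ∷_) (∈-subsets S))
∈-subsets {suc n} (false ∷ S) = ∈-++⁺ʳ (List.map (true ∷_) (subsets n)) (∈-map⁺ (false ∷_) (∈-subsets S))

∈⇒lookup : ∀ {n} {S : Subset n} {x} → x ∈ S → lookup S x ≡ true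
∈⇒lookup = []=⇒lookup

lookup⇒∈ : ∀ {n} {S : Subset n} {x} → lookup S x ≡ true → x ∈ S
lookup⇒∈ = lookup⇒[]= _ _

∉⇒lookup : ∀ {n} {S : Subset n} {x} → x ∉ S → lookup S x ≡ false
∉⇒lookup x∉S = Bool.¬-not (x∉S ∘ lookup⇒∈)

xor-true : ∀ x y → x xor y ≡ true → x ≡ true ⊎ y ≡ true
xor-true true  y _  = inj₁ refl
xor-true false y eq = inj₂ eq

∈-⊕ : ∀ {n} {c d : Subset n} {x} → x ∈ c ⊕ d → x ∈ c ⊎ x ∈ d
∈-⊕ {c = c} {d} {x} x∈ = Sum.map lookup⇒∈ lookup⇒∈
  (xor-true (lookup c x) (lookup d x) (trans (sym (lookup-zipWith _xor_ x c d)) (∈⇒lookup x∈)))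

-- Bases of rows and matrices that factor through 𝔽₂ᵐ

module _ (M : Matrix p q) where

  independent⇒≤rank : ∀ {S} → Independent M S → ∣ S ∣ ≤ rank M
  independent⇒≤rank {S} ind = All.lookup (xs≤max 0 _)
    (∈-map⁺ ∣_∣ (∈-filter⁺ (independent? M) (∈-subsets S) ind))

  rank≤ : ∀ {k} → (∀ S → Independent M S → ∣ S ∣ ≤ k) → rank M ≤ k
  rank≤ {k} bound = f[argmax]≤v⁺ z≤n (All.tabulate λ s∈ →
    let S , S∈ , s≡∣S∣ = ∈-map⁻ ∣_∣ s∈ in
    subst (_≤ k) (sym s≡∣S∣) (bound S (proj₂ (∈-filter⁻ (independent? M) {xs = subsets p} S∈))))

  basis : ∃[ S ] Independent M S × ∣ S ∣ ≡ rank M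
  basis with argmax-sel id 0 (List.map ∣_∣ (List.filter (independent? M) (subsets p)))
  -- If the maximum is its default 0, the empty set of rows is a basis.
  ... | inj₁ eq = Subset.⊥ , (λ (c , c⊆⊥ , (x , x∈) , _) → ∉⊥ (c⊆⊥ x∈)) , trans (∣⊥∣≡0 p) (sym eq)
  ... | inj₂ r∈ with ∈-map⁻ ∣_∣ r∈
  ...   | S , S∈ , eq = S , proj₂ (∈-filter⁻ (independent? M) {xs = subsets p} S∈) , sym eq

  dependency? : ∀ S → Dec (∃ (IsDependency M S))
  dependency? S = anySubset? λ c →
    c ⊆? S ×-dec nonempty? c ×-dec all? (λ j → combination M c j Bool.≟ false)

  -- A row `i` outside `S` makes `S ∪ ⁅ i ⁆` dependent, because `S` has the largest size. The
  -- dependency must involve `i`, and in characteristic 2 deleting `i` from it gives the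
  -- coefficients of row `i`.
  basis-spans : ∀ {S} → Independent M S → ∣ S ∣ ≡ rank M →
    ∀ i → ∃[ c ] c ⊆ S × (∀ j → combination M c j ≡ M i j)
  basis-spans {S} ind size i with i ∈? S
  ... | yes i∈S = ⁅ i ⁆ , (λ {x} x∈ → subst (_∈ S) (sym (x∈⁅y⁆⇒x≡y i x∈)) i∈S) , λ j → pairing-⁅⁆ i (λ i → M i j)
  ... | no  i∉S with decidable-stable (dependency? (S ∪ ⁅ i ⁆)) (λ ind′ → contradiction
      (≤-trans (p⊂q⇒∣p∣<∣q∣ (p⊆p∪q ⁅ i ⁆ , i , q⊆p∪q S ⁅ i ⁆ (x∈⁅x⁆ i) , i∉S)) (independent⇒≤rank ind′))
      (<-irrefl size))
  ...   | c , c⊆ , nonempty , vanishes with i ∈? c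
  ...     | no  i∉c = contradiction
    (c , (λ {x} x∈c → [ id , (λ x∈i → contradiction (subst (_∈ c) (x∈⁅y⁆⇒x≡y i x∈i) x∈c) i∉c) ]′
            (x∈p∪q⁻ S ⁅ i ⁆ (c⊆ x∈c))) , nonempty , vanishes) ind
  ...     | yes i∈c = c ⊕ ⁅ i ⁆ , within ,
    λ j → trans (pairing-⊕ c ⁅ i ⁆ (λ i → M i j)) (cong₂ _xor_ (vanishes j) (pairing-⁅⁆ i (λ i → M i j)))
    where
    i∉c⊕i : i ∉ c ⊕ ⁅ i ⁆
    i∉c⊕i i∈ = contradiction
      (trans (sym (∈⇒lookup i∈)) (trans (lookup-zipWith _xor_ i c ⁅ i ⁆) (cong₂ _xor_ (∈⇒lookup i∈c) (∈⇒lookup (x∈⁅x⁆ i)))))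
      λ ()
    ≡i : ∀ {x} → x ∈ ⁅ i ⁆ → x ∈ c ⊕ ⁅ i ⁆ → x ∈ S
    ≡i x∈i x∈ = contradiction (subst (_∈ c ⊕ ⁅ i ⁆) (x∈⁅y⁆⇒x≡y i x∈i) x∈) i∉c⊕i
    within : c ⊕ ⁅ i ⁆ ⊆ S
    within x∈ with ∈-⊕ {c = c} x∈
    ... | inj₂ x∈i = ≡i x∈i x∈
    ... | inj₁ x∈c = [ id , (λ x∈i → ≡i x∈i x∈) ]′ (x∈p∪q⁻ S ⁅ i ⁆ (c⊆ x∈c))

  module _ (a : Fin p → Vec Bool m) (b : Fin q → Vec Bool m) (factor : ∀ i j → M i j ≡ dot (a i) (b j)) where

    combination-dot : ∀ c j → combination M c j ≡ dot (superpose c a) (b j)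
    combination-dot c j = trans (sum-cong-≗ λ i → cong (lookup c i ∧_) (factor i j))
                                (sym (dot-superpose c a (b j)))

    -- Two subsets of an independent `S` with the same vector sum in 𝔽₂ᵐ would differ by a
    -- dependency. So the `2 ^ ∣ S ∣` sums are distinct.
    rank≤dim : rank M ≤ m
    rank≤dim = rank≤ λ S ind → ≮⇒≥ λ m<∣S∣ → contradiction
      (≤-trans (≤-reflexive (sym (#⊆ S))) (#≤2^-injective (_⊆ᵇ S) (λ c → superpose c a) (injective S ind)))
      (<⇒≱ (^-monoʳ-< 2 (s≤s (s≤s z≤n)) m<∣S∣))
      where
      injective : ∀ S → Independent M S → ∀ c d → c ⊆ᵇ S ≡ true → d ⊆ᵇ S ≡ true →
                  superpose c a ≡ superpose d a → c ≡ d
      injective S ind c d c⊆S d⊆S eq = ⊕-≡ λ i → ∉⇒lookup λ i∈ → ind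
        ( c ⊕ d
        , (λ {x} x∈ → [ ⊆ᵇ⇒⊆ c S c⊆S , ⊆ᵇ⇒⊆ d S d⊆S ]′ (∈-⊕ {c = c} x∈))
        , (i , i∈)
        , λ j → trans (pairing-⊕ c d (λ i → M i j)) (trans
            (cong (combination M c j xor_) (trans (combination-dot d j)
              (trans (cong (λ v → dot v (b j)) (sym eq)) (sym (combination-dot c j)))))
            (xor-same (combination M c j))))

    -- Every row is one of `2 ^ rank M` combinations of a basis. Vectors sharing a combination have
    -- equal scalar products with each vector of `B`, so there are few of them by
    -- `translated-orthogonal-bound`.
    rank-counts : ∀ (A B : Vec Bool m → Bool) →
      (∀ v → A v ≡ true → ∃[ i ] a i ≡ v) → (∀ w → B w ≡ true → ∃[ j ] b j ≡ w) →
      # A * # B ≤ 2 ^ rank M * 2 ^ m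
    rank-counts A B A-rows B-columns with basis
    ... | S , ind , size = begin
      # A * # B
        ≤⟨ *-monoˡ-≤ (# B) rows-by-combination ⟩
      ∑ p (λ c → χ (c ⊆ᵇ S) * # (like c)) * # B
        ≡⟨ ∑-*ʳ (λ c → χ (c ⊆ᵇ S) * # (like c)) (# B) ⟨
      ∑ p (λ c → χ (c ⊆ᵇ S) * # (like c) * # B)
        ≤⟨ ∑-mono (λ c → ≤-trans (≤-reflexive (*-assoc (χ (c ⊆ᵇ S)) (# (like c)) (# B)))
                                 (*-monoʳ-≤ (χ (c ⊆ᵇ S)) (like-bound c))) ⟩
      ∑ p (λ c → χ (c ⊆ᵇ S) * 2 ^ m)
        ≡⟨ ∑-*ʳ (λ c → χ (c ⊆ᵇ S)) (2 ^ m) ⟩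
      # (_⊆ᵇ S) * 2 ^ m
        ≡⟨ cong (_* 2 ^ m) (trans (#⊆ S) (cong (2 ^_) size)) ⟩
      2 ^ rank M * 2 ^ m ∎
      where
      open ≤-Reasoning
      like? : ∀ c v → Dec (∀ j → combination M c j ≡ dot v (b j))
      like? c v = all? λ j → combination M c j Bool.≟ dot v (b j)

      like : Subset p → Vec Bool m → Bool
      like c v = does (like? c v)

      like-bound : ∀ c → # (like c) * # B ≤ 2 ^ m
      like-bound c = translated-orthogonal-bound (like c) B λ v v′ w cv cv′ Bw →
        let j , bj≡w = B-columns w Bw in
        subst (λ w → dot v w ≡ dot v′ w) bj≡w
          (trans (sym (does-true (like? c v) cv j)) (does-true (like? c v′) cv′ j))

      row : ∀ v → χ (A v) ≤ ∑ p (λ c → χ (c ⊆ᵇ S) * χ (like c v))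
      row v with A v in Av
      ... | false = z≤n
      ... | true with A-rows v Av
      ...   | i , refl with basis-spans ind size i
      ...     | c , c⊆S , c≡i = ≤-trans
        (≤-reflexive (sym (cong₂ (λ x y → χ x * χ y) (⊆⇒⊆ᵇ c S c⊆S)
          (dec-true (like? c v) λ j → trans (c≡i j) (factor i j)))))
        (∑-∋ {f = λ c → χ (c ⊆ᵇ S) * χ (like c v)} c)

      rows-by-combination : # A ≤ ∑ p (λ c → χ (c ⊆ᵇ S) * # (like c))
      rows-by-combination = begin
        # A
          ≤⟨ ∑-mono row ⟩
        ∑ m (λ v → ∑ p (λ c → χ (c ⊆ᵇ S) * χ (like c v)))
          ≡⟨ ∑-swap m p _ ⟩
        ∑ p (λ c → ∑ m (λ v → χ (c ⊆ᵇ S) * χ (like c v)))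
          ≡⟨ ∑-cong (λ c → ∑-*ˡ (χ ∘ like c) (χ (c ⊆ᵇ S))) ⟩
        ∑ p (λ c → χ (c ⊆ᵇ S) * # (like c)) ∎

-- Rooting a branch decomposition

lookup-injective : ∀ {A : Set} {xs : List A} → Unique xs →
  ∀ {i j} → List.lookup xs i ≡ List.lookup xs j → i ≡ j
lookup-injective (_ ∷ _)    {zero}  {zero}  _  = refl
lookup-injective (x∉ ∷ _)   {zero}  {suc j} eq = contradiction eq (All.lookup x∉ (∈-lookup j))
lookup-injective (x∉ ∷ _)   {suc i} {zero}  eq = contradiction (sym eq) (All.lookup x∉ (∈-lookup i))
lookup-injective (_ ∷ uniq) {suc i} {suc j} eq = cong suc (lookup-injective uniq eq)

unique⇒length≤ : ∀ {A : Set} {xs ys : List A} → Unique xs → (∀ {x} → x ∈ₗ xs → x ∈ₗ ys) →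
  length xs ≤ length ys
unique⇒length≤ {xs = xs} {ys} uniq xs⊆ys = injective⇒≤ {f = λ i → Any.index (xs⊆ys (∈-lookup i))}
  λ {i} {j} eq → lookup-injective uniq (begin
    List.lookup xs i  ≡⟨ lookup-index (xs⊆ys (∈-lookup i)) ⟩
    List.lookup ys _  ≡⟨ cong (List.lookup ys) eq ⟩
    List.lookup ys _  ≡⟨ lookup-index (xs⊆ys (∈-lookup j)) ⟨
    List.lookup xs j  ∎)
  where open ≡-Reasoning

trues : ∀ {n} → (Fin n → Bool) → List (Fin n)
trues {zero}  P = []
trues {suc n} P with P zero
... | true  = zero ∷ map suc (trues (P ∘ suc))
... | false = map suc (trues (P ∘ suc))

zero∉map-suc : ∀ {n} (xs : List (Fin n)) → All {A = Fin (suc n)} (zero ≢_) (map suc xs)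
zero∉map-suc []       = []
zero∉map-suc (x ∷ xs) = (λ ()) ∷ zero∉map-suc xs

trues-unique : ∀ {n} (P : Fin n → Bool) → Unique (trues P)
trues-unique {zero}  P = []
trues-unique {suc n} P with P zero
... | true  = zero∉map-suc _ ∷ Unique.map⁺ Fin.suc-injective (trues-unique (P ∘ suc))
... | false = Unique.map⁺ Fin.suc-injective (trues-unique (P ∘ suc))

∈-trues⁺ : ∀ {n} (P : Fin n → Bool) {x} → P x ≡ true → x ∈ₗ trues P
∈-trues⁺ P {zero}  Px with P zero
... | true  = here refl
∈-trues⁺ P {suc x} Px with P zero
... | true  = there (∈-map⁺ suc (∈-trues⁺ (P ∘ suc) Px))
... | false = ∈-map⁺ suc (∈-trues⁺ (P ∘ suc) Px)

∈-trues⁻ : ∀ {n} (P : Fin n → Bool) {x} → x ∈ₗ trues P → P x ≡ true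
∈-trues⁻ {suc n} P {x} x∈ with P zero in eq
∈-trues⁻ {suc n} P {x} (here refl) | true = eq
∈-trues⁻ {suc n} P {x} (there x∈) | true with ∈-map⁻ suc x∈
... | _ , y∈ , refl = ∈-trues⁻ (P ∘ suc) y∈
∈-trues⁻ {suc n} P {x} x∈ | false with ∈-map⁻ suc x∈
... | _ , y∈ , refl = ∈-trues⁻ (P ∘ suc) y∈

length-trues : ∀ {n} (P : Fin n → Bool) → length (trues P) ≡ ∣ tabulate P ∣
length-trues {zero}  P = refl
length-trues {suc n} P with P zero
... | true  = cong suc (trans (length-map suc (trues (P ∘ suc))) (length-trues (P ∘ suc)))
... | false = trans (length-map suc (trues (P ∘ suc))) (length-trues (P ∘ suc))

data Tree (n : ℕ) : Set where
  leaf : Fin n → Tree n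
  node : (l r : Tree n) → Tree n

module _ {n : ℕ} where

  ⟦_⟧ : Tree n → Subset n
  ⟦ leaf x ⟧   = ⁅ x ⁆
  ⟦ node l r ⟧ = ⟦ l ⟧ ∪ ⟦ r ⟧

  Proper : Tree n → Set
  Proper (leaf x)   = ⊤
  Proper (node l r) = (∀ x → x ∈ ⟦ l ⟧ → x ∉ ⟦ r ⟧) × Proper l × Proper r

  Everywhere : (Subset n → Set) → Tree n → Set
  Everywhere P (leaf x)   = P ⁅ x ⁆
  Everywhere P (node l r) = P (⟦ l ⟧ ∪ ⟦ r ⟧) × Everywhere P l × Everywhere P r

-- Walks in a tree that avoid a vertex

module Walks {size : ℕ} (G : Graph size) (isTree : Graph.IsTree G) where
  open Graph G

  adj-sym : ∀ {u v} → Adj u v → Adj v u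
  adj-sym {u} {v} uv = trans (symmetric v u) uv

  adj⇒≢ : ∀ {u v} → Adj u v → u ≢ v
  adj⇒≢ {u} uv refl = contradiction (trans (sym (loopless u)) uv) λ ()

  -- Removing the vertex `v` is easier to carry through a recursion than removing an edge at `v`. By
  -- `without⇔off` both removals let a neighbour of `v` reach the same vertices.
  Off : Fin size → Fin size → Fin size → Set
  Off v a b = Adj a b × a ≢ v × b ≢ v

  off-sym : ∀ {v a b} → Off v a b → Off v b a
  off-sym (ab , a≢v , b≢v) = adj-sym ab , b≢v , a≢v

  data Path (R : Fin size → Fin size → Set) : Fin size → Fin size → List (Fin size) → Set where
    stop : ∀ {a} → Path R a a (a ∷ [])
    _∷_ : ∀ {a b c xs} → R a b → Path R b c xs → Path R a c (a ∷ xs)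

  suffix : ∀ {R a b c xs} → Path R b c xs → Unique xs → a ∈ₗ xs → ∃[ ys ] Path R a c ys × Unique ys
  suffix p@(stop)  uniq       (here refl) = _ , p , uniq
  suffix p@(_ ∷ _)  uniq       (here refl) = _ , p , uniq
  suffix (_ ∷ p)    (_ ∷ uniq) (there a∈)  = suffix p uniq a∈

  shorten : ∀ {R a c} → Star R a c → ∃[ xs ] Path R a c xs × Unique xs
  shorten {a = a} ε = _ , stop , [] ∷ []
  shorten {a = a} (ab ◅ bc) with shorten bc
  ... | xs , p , uniq with Any.any? (a Fin.≟_) xs
  ...   | yes a∈xs = suffix p uniq a∈xs
  ...   | no  a∉xs = _ , ab ∷ p , ¬Any⇒All¬ xs a∉xs ∷ uniq

  off-path : ∀ {v a c xs} → Path (Off v) a c xs → a ≢ v → All (v ≢_) xs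
  off-path stop                   a≢v = ≢-sym a≢v ∷ []
  off-path ((_ , _ , b≢v) ∷ p) a≢v = ≢-sym a≢v ∷ off-path p b≢v

  path-linked : ∀ {v a c xs} → Path (Off v) a c xs → Adj c v → Linked Adj (xs ++ [ v ])
  path-linked stop                         cv = cv ∷ [-]
  path-linked ((ab , _) ∷ p@(stop)) cv = ab ∷ path-linked p cv
  path-linked ((ab , _) ∷ p@(_ ∷ _)) cv = ab ∷ path-linked p cv

  -- Shortened to a path, the walk would close up through `v` to a cycle.
  no-detour : ∀ {v a c} → Adj v a → Adj v c → a ≢ c → ¬ Star (Off v) a c
  no-detour {v} {a} {c} va vc a≢c walk with shorten walk
  ... | xs , p , uniq = proj₂ isTree
    (v , xs , long p a≢c , off-path p (≢-sym (adj⇒≢ va)) ∷ uniq , closed p (path-linked p (adj-sym vc)))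
    where
    long : ∀ {R a c xs} → Path R a c xs → a ≢ c → 2 ≤ length xs
    long stop           a≢c = contradiction refl a≢c
    long (_ ∷ stop)     _   = s≤s (s≤s z≤n)
    long (_ ∷ (_ ∷ _)) _   = s≤s (s≤s z≤n)
    closed : ∀ {R c xs} → Path R a c xs → Linked Adj (xs ++ [ v ]) → Linked Adj (v ∷ xs ++ [ v ])
    closed stop   linked = va ∷ linked
    closed (_ ∷ _) linked = va ∷ linked

  off⇒without : ∀ {c v a b} → Off v a b → AdjWithout c v a b
  off⇒without (ab , a≢v , b≢v) = ab , λ { (inj₁ (_ , b≡v)) → b≢v b≡v ; (inj₂ (a≡v , _)) → a≢v a≡v }

  -- A first arrival at `v` would come from a neighbour other than `c`, since the edge between `c`
  -- and `v` is barred; the walk up to there would be a detour around `v`.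
  without⇒off : ∀ {c v y} → Adj c v → Star (AdjWithout c v) c y → Star (Off v) c y
  without⇒off {c} {v} cv = go ε (adj⇒≢ cv)
    where
    go : ∀ {a y} → Star (Off v) c a → a ≢ v → Star (AdjWithout c v) a y → Star (Off v) c y
    go c⋯a a≢v ε = c⋯a
    go {a} c⋯a a≢v (_◅_ {j = b} (ab , ab≢) rest) with b Fin.≟ v
    ... | no  b≢v  = go (c⋯a ◅◅ (ab , a≢v , b≢v) ◅ ε) b≢v rest
    ... | yes refl = contradiction c⋯a
      (no-detour (adj-sym cv) (adj-sym ab) λ { refl → ab≢ (inj₁ (refl , refl)) })

  without⇔off : ∀ {c v y} → Adj c v → Star (AdjWithout c v) c y ⇔ Star (Off v) c y
  without⇔off cv = mk⇔ (without⇒off cv) (Star.map off⇒without)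

  off-end : ∀ {u w y} → w ≢ u → Star (Off u) w y → y ≢ u
  off-end w≢u ε                   = w≢u
  off-end w≢u ((_ , _ , b≢u) ◅ s) = off-end b≢u s

  reroute : ∀ {v u w a y} → (∀ {z} → Star (Off v) w z → z ≢ u) →
            Star (Off v) w a → Star (Off v) a y → Star (Off u) a y
  reroute ≢u w⋯a ε = ε
  reroute ≢u w⋯a (e@(ab , _) ◅ s) =
    (ab , ≢u w⋯a , ≢u (w⋯a ◅◅ e ◅ ε)) ◅ reroute ≢u (w⋯a ◅◅ e ◅ ε) s

  -- Cuts the walk after its last visit to `v`. When the walk starts at `v`, the third case is void
  -- and the second names the branch at `v` containing `y`.
  last-exit : ∀ {u w y} v → Star (Off u) w y →
    y ≡ v ⊎ (∃[ c ] Adj v c × c ≢ u × Star (Off v) c y) ⊎ (w ≢ v × Star (Off v) w y)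
  last-exit {w = w} v ε with w Fin.≟ v
  ... | yes w≡v = inj₁ w≡v
  ... | no  w≢v = inj₂ (inj₂ (w≢v , ε))
  last-exit {w = w} v ((wb , _ , b≢u) ◅ s) with last-exit v s
  ... | inj₁ y≡v = inj₁ y≡v
  ... | inj₂ (inj₁ exit) = inj₂ (inj₁ exit)
  ... | inj₂ (inj₂ (b≢v , s′)) with w Fin.≟ v
  ...   | yes refl = inj₂ (inj₁ (_ , wb , b≢u , s′))
  ...   | no  w≢v  = inj₂ (inj₂ (w≢v , (wb , w≢v , b≢v) ◅ s′))

  exclusive : ∀ {u v y} → Adj u v → Star (Off u) v y → ¬ Star (Off v) u y
  exclusive {u} {v} uv v⋯y u⋯y =
    off-end (≢-sym (adj⇒≢ uv)) (without⇒off (adj-sym uv) (v⋯y′ ◅◅ Star.reverse without-sym u⋯y′)) refl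
    where
    without-sym : ∀ {a b} → AdjWithout v u a b → AdjWithout v u b a
    without-sym (ab , ≢) = adj-sym ab , λ { (inj₁ (p , q)) → ≢ (inj₂ (q , p)) ; (inj₂ (p , q)) → ≢ (inj₁ (q , p)) }
    swap : ∀ {a b} → AdjWithout u v a b → AdjWithout v u a b
    swap (ab , ≢) = ab , ≢ ∘ Sum.swap
    v⋯y′ = Star.map (off⇒without {v} {u}) v⋯y
    u⋯y′ = Star.map (swap ∘ off⇒without {u} {v}) u⋯y

  -- A walk from `y` to `u`, stopped at its first vertex among `u` and `v`, does not use the edge
  -- between them.
  exhaustive : ∀ {u v} → Adj u v → ∀ y → Star (Off u) v y ⊎ Star (Off v) u y
  exhaustive {u} {v} uv y with ends (proj₁ isTree y u)
    where
    ends : ∀ {y} → Star Adj y u → Star (AdjWithout v u) u y ⊎ Star (AdjWithout v u) v y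
    ends ε = inj₁ ε
    ends {y} (_◅_ {j = b} yb s) with y Fin.≟ u | y Fin.≟ v
    ... | yes refl | _        = inj₁ ε
    ... | _        | yes refl = inj₂ ε
    ... | no y≢u   | no y≢v   = Sum.map (_◅◅ e ◅ ε) (_◅◅ e ◅ ε) (ends s)
      where
      e : AdjWithout v u b y
      e = adj-sym yb , λ { (inj₁ (_ , y≡u)) → y≢u y≡u ; (inj₂ (_ , y≡v)) → y≢v y≡v }
  ... | inj₁ u⋯y = inj₂ (without⇒off uv (Star.map (λ (ab , ≢) → ab , ≢ ∘ Sum.swap) u⋯y))
  ... | inj₂ v⋯y = inj₁ (without⇒off (adj-sym uv) v⋯y)

  neighbours : Fin size → List (Fin size)
  neighbours v = trues (adj v)

  degree-1 : ∀ {v u b} → degree v ≡ 1 → Adj v u → Adj v b → b ≡ u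
  degree-1 {v} deg vu vb with neighbours v | trans (length-trues (adj v)) deg
                            | ∈-trues⁺ (adj v) vu | ∈-trues⁺ (adj v) vb
  ... | _ ∷ [] | _ | here refl | here refl = refl

  degree-3 : ∀ {v u} → degree v ≡ 3 → Adj v u →
    ∃₂ λ a b → Adj v a × Adj v b × a ≢ u × b ≢ u × a ≢ b × (∀ {c} → Adj v c → c ≢ u → c ≡ a ⊎ c ≡ b)
  degree-3 {v} {u} deg vu
    with neighbours v | trans (length-trues (adj v)) deg | ∈-trues⁺ (adj v) vu | trues-unique (adj v)
       | (λ {x} → ∈-trues⁻ (adj v) {x}) | (λ {x} → ∈-trues⁺ (adj v) {x})
  ... | x ∷ y ∷ z ∷ [] | _ | here refl | ((x≢y ∷ x≢z ∷ []) ∷ (y≢z ∷ []) ∷ _) | adj⁻ | adj⁺ =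
    y , z , adj⁻ (there (here refl)) , adj⁻ (there (there (here refl))) , ≢-sym x≢y , ≢-sym x≢z , y≢z ,
    λ vc c≢u → case adj⁺ vc of λ
      { (here c≡x) → contradiction c≡x c≢u ; (there (here c≡y)) → inj₁ c≡y ; (there (there (here c≡z))) → inj₂ c≡z }
  ... | x ∷ y ∷ z ∷ [] | _ | there (here refl) | ((x≢y ∷ x≢z ∷ []) ∷ (y≢z ∷ []) ∷ _) | adj⁻ | adj⁺ =
    x , z , adj⁻ (here refl) , adj⁻ (there (there (here refl))) , x≢y , ≢-sym y≢z , x≢z ,
    λ vc c≢u → case adj⁺ vc of λ
      { (here c≡x) → inj₁ c≡x ; (there (here c≡y)) → contradiction c≡y c≢u ; (there (there (here c≡z))) → inj₂ c≡z }
  ... | x ∷ y ∷ z ∷ [] | _ | there (there (here refl)) | ((x≢y ∷ x≢z ∷ []) ∷ (y≢z ∷ []) ∷ _) | adj⁻ | adj⁺ =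
    x , y , adj⁻ (here refl) , adj⁻ (there (here refl)) , x≢z , y≢z , x≢y ,
    λ vc c≢u → case adj⁺ vc of λ
      { (here c≡x) → inj₁ c≡x ; (there (here c≡y)) → inj₂ c≡y ; (there (there (here c≡z))) → contradiction c≡z c≢u }

module Rooting {n} (D : BranchDecomposition (suc n)) where
  open BranchDecomposition D
  open Walks tree isTree

  leafAt-degree : ∀ x → degree (leafAt x) ≡ 1
  leafAt-degree x = proj₂ (Inverse.from leaves x)

  label : ∀ {v} → degree v ≡ 1 → ∃[ x ] leafAt x ≡ v
  label {v} deg = Inverse.to leaves (v , deg) , cong proj₁ (Inverse.strictlyInverseʳ leaves (v , deg))

  leafAt-injective : ∀ {x y} → leafAt x ≡ leafAt y → x ≡ y
  leafAt-injective {x} {y} eq = trans (sym (Inverse.strictlyInverseˡ leaves x))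
    (trans (cong (Inverse.to leaves) (same (Inverse.from leaves x) (Inverse.from leaves y) eq))
           (Inverse.strictlyInverseˡ leaves y))
    where
    same : ∀ (s t : Leaf) → proj₁ s ≡ proj₁ t → s ≡ t
    same (s , p) (_ , q) refl = cong (s ,_) (≡-irrelevant p q)

  -- An edge enters the width with both of its orientations, so the two sets are carried along
  -- together.
  Shown : Subset (suc n) → Set
  Shown A = Displayed A × Displayed (∁ A)

  Side : Fin size → Fin size → Subset (suc n) → Set
  Side u v A = ∀ x → x ∈ A ⇔ Star (Off u) v (leafAt x)

  side⇒shown : ∀ {u v A} → Adj u v → Side u v A → Shown A
  side⇒shown {u} {v} {A} uv side =
    (v , u , adj-sym uv , λ x → mk⇔ (from (without⇔off (adj-sym uv)) ∘ to (side x))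
                                    (from (side x) ∘ to (without⇔off (adj-sym uv)))) ,
    (u , v , uv , λ x → mk⇔
      (λ x∈∁A → [ (λ v⋯x → contradiction (from (side x) v⋯x) (x∈∁p⇒x∉p x∈∁A)) , from (without⇔off uv) ]′
                  (exhaustive uv (leafAt x)))
      (λ u⋯x → x∉p⇒x∈∁p λ x∈A → exclusive uv (to (side x) x∈A) (to (without⇔off uv) u⋯x)))

  record Branch (u v : Fin size) : Set where
    field
      branch : Tree (suc n)
      side   : Side u v ⟦ branch ⟧
      proper : Proper branch
      shown  : Everywhere Shown branch
  open Branch

  leaf-branch : ∀ {u v} → Adj u v → degree v ≡ 1 → Branch u v
  leaf-branch {u} {v} uv deg with label deg
  ... | x , refl = record
    { branch = leaf x ; side = side-x ; proper = tt ; shown = side⇒shown uv side-x }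
    where
    only : ∀ y → Star (Off u) (leafAt x) (leafAt y) → leafAt x ≡ leafAt y
    only y s with leafAt y
    only y ε                      | _ = refl
    only y ((vb , _ , b≢u) ◅ _) | _ = contradiction (degree-1 deg (adj-sym uv) vb) b≢u
    side-x : Side u (leafAt x) ⁅ x ⁆
    side-x y = mk⇔ (λ y∈ → subst (Star (Off u) (leafAt x) ∘ leafAt) (sym (x∈⁅y⁆⇒x≡y x y∈)) ε)
                   (λ s → subst (_∈ ⁅ x ⁆) (leafAt-injective (only y s)) (x∈⁅x⁆ x))

  node-branch : ∀ {u v a b} → Adj u v → degree v ≡ 3 → Adj v a → Adj v b → a ≢ u → b ≢ u → a ≢ b →
    (∀ {c} → Adj v c → c ≢ u → c ≡ a ⊎ c ≡ b) → Branch v a → Branch v b → Branch u v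
  node-branch {u} {v} {a} {b} uv deg va vb a≢u b≢u a≢b only Ta Tb = record
    { branch = node (branch Ta) (branch Tb)
    ; side   = side-v
    ; proper = disjoint , proper Ta , proper Tb
    ; shown  = side⇒shown uv side-v , shown Ta , shown Tb
    }
    where
    disjoint : ∀ x → x ∈ ⟦ branch Ta ⟧ → x ∉ ⟦ branch Tb ⟧
    disjoint x x∈a x∈b = no-detour va vb a≢b (to (side Ta x) x∈a ◅◅ Star.reverse off-sym (to (side Tb x) x∈b))

    extend : ∀ {c y} → Adj v c → c ≢ u → Star (Off v) c y → Star (Off u) v y
    extend vc c≢u s = (vc , ≢-sym (adj⇒≢ uv) , c≢u) ◅
      reroute (λ { c⋯z refl → no-detour vc (adj-sym uv) c≢u c⋯z }) ε s

    split : ∀ x → Star (Off u) v (leafAt x) → x ∈ ⟦ branch Ta ⟧ ⊎ x ∈ ⟦ branch Tb ⟧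
    split x s with last-exit v s
    ... | inj₁ x≡v = contradiction (trans (sym (leafAt-degree x)) (trans (cong degree x≡v) deg)) λ ()
    ... | inj₂ (inj₂ (v≢v , _)) = contradiction refl v≢v
    ... | inj₂ (inj₁ (c , vc , c≢u , c⋯x)) with only vc c≢u
    ...   | inj₁ refl = inj₁ (from (side Ta x) c⋯x)
    ...   | inj₂ refl = inj₂ (from (side Tb x) c⋯x)

    side-v : Side u v (⟦ branch Ta ⟧ ∪ ⟦ branch Tb ⟧)
    side-v x = mk⇔
      (λ x∈ → [ (λ x∈a → extend va a≢u (to (side Ta x) x∈a)) , (λ x∈b → extend vb b≢u (to (side Tb x) x∈b)) ]′
                (x∈p∪q⁻ ⟦ branch Ta ⟧ ⟦ branch Tb ⟧ x∈))
      (λ s → x∈p∪q⁺ (split x s))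

  walk-back : ∀ {v u xs} → Linked Adj (u ∷ xs) → All (v ≢_) (u ∷ xs) → ∀ {a} → a ∈ₗ (u ∷ xs) → Star (Off v) u a
  walk-back linked (_ ∷ _) (here refl) = ε
  walk-back (ub ∷ linked) (v≢u ∷ v≢b ∷ v∉) (there a∈) =
    (ub , ≢-sym v≢u , ≢-sym v≢b) ◅ walk-back linked (v≢b ∷ v∉) a∈

  -- The branch is explored along a path without repetitions, which bounds the depth.
  grow : ∀ fuel {u v xs} → size ≤ fuel + length (v ∷ u ∷ xs) →
         Unique (v ∷ u ∷ xs) → Linked Adj (v ∷ u ∷ xs) → Branch u v
  grow fuel {u} {v} {xs} enough uniq@(v∉ ∷ _) linked@(vu ∷ linked′) with degree v ≟ 1
  ... | yes deg≡1 = leaf-branch (adj-sym vu) deg≡1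
  ... | no  deg≢1 with cubic v deg≢1
  ...   | deg≡3 with degree-3 deg≡3 vu
  ...     | a , b , va , vb , a≢u , b≢u , a≢b , only =
    node-branch (adj-sym vu) deg≡3 va vb a≢u b≢u a≢b only (next fuel enough va a≢u) (next fuel enough vb b≢u)
    where
    fresh : ∀ {c} → Adj v c → c ≢ u → c ∉ₗ (v ∷ u ∷ xs)
    fresh vc c≢u (here c≡v) = adj⇒≢ vc (sym c≡v)
    -- The path back from `u` to `c` would be a detour around `v`.
    fresh vc c≢u (there c∈) = no-detour vu vc (≢-sym c≢u) (walk-back linked′ v∉ c∈)

    next : ∀ fuel → size ≤ fuel + length (v ∷ u ∷ xs) → ∀ {c} → Adj v c → c ≢ u → Branch v c
    -- The path already has at least `size` vertices, and `c` would be one more.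
    next zero enough {c} vc c≢u = contradiction
      (≤-trans (unique⇒length≤ (¬Any⇒All¬ _ (fresh vc c≢u) ∷ uniq) (λ {x} _ → ∈-allFin x))
               (≤-trans (≤-reflexive (length-tabulate id)) enough))
      (n≮n _)
    next (suc fuel) enough vc c≢u = grow fuel (≤-trans enough (≤-reflexive (sym (+-suc fuel _))))
      (¬Any⇒All¬ _ (fresh vc c≢u) ∷ uniq) (adj-sym vc ∷ linked)

  -- The leaf labelled `zero` has a single neighbour, and the branch behind that edge holds all
  -- other labels.
  rooted : ∃[ T ] Proper T × Everywhere Shown T × (∀ x → x ∈ ⟦ T ⟧ ⇔ x ≢ zero)
  rooted with trues (adj root) in eq | trans (length-trues (adj root)) (leafAt-degree zero)
    where root = leafAt zero
  ... | v ∷ [] | _ = branch B , proper B , shown B , λ x → mk⇔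
    (λ { x∈ refl → off-end (≢-sym (adj⇒≢ rv)) (to (side B zero) x∈) refl })
    (λ x≢0 → from (side B x) ([ id , (λ s → contradiction (sym (leafAt-injective (only x s))) x≢0) ]′
                                (exhaustive rv (leafAt x))))
    where
    root = leafAt zero
    rv : Adj root v
    rv = ∈-trues⁻ (adj root) (subst (v ∈ₗ_) (sym eq) (here refl))
    B : Branch root v
    B = grow size (m≤m+n size _) ((≢-sym (adj⇒≢ rv) ∷ []) ∷ [] ∷ []) (adj-sym rv ∷ [-])
    only : ∀ x → Star (Off v) root (leafAt x) → root ≡ leafAt x
    only x s with leafAt x
    only x ε                      | _ = refl
    only x ((rb , _ , b≢v) ◅ _) | _ = contradiction (degree-1 (leafAt-degree zero) rv rb) b≢v

-- From a rooted tree to a branch decomposition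

-- Each subtree stands for the edge above it; the root stands for the edge to the leaf labelled
-- `zero`.
sets : ∀ {n} → Tree n → List (Subset n)
sets (leaf x)   = ⁅ x ⁆ ∷ ∁ ⁅ x ⁆ ∷ []
sets (node l r) = ⟦ node l r ⟧ ∷ ∁ ⟦ node l r ⟧ ∷ sets l ++ sets r

everywhere⇒sets : ∀ {n} {P : Subset n → Set} T → Everywhere (λ A → P A × P (∁ A)) T → ∀ {A} → A ∈ₗ sets T → P A
everywhere⇒sets (leaf x)   (p , q)            (here refl)         = p
everywhere⇒sets (leaf x)   (p , q)            (there (here refl)) = q
everywhere⇒sets (node l r) ((p , q) , _ , _)  (here refl)         = p
everywhere⇒sets (node l r) ((p , q) , _ , _)  (there (here refl)) = q
everywhere⇒sets (node l r) (_ , everyl , everyr) (there (there A∈)) =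
  [ everywhere⇒sets l everyl , everywhere⇒sets r everyr ]′ (∈-++⁻ (sets l) A∈)

-- Positions in a binary tree and their numbering

data Pos {n} : Tree n → Set where
  here  : ∀ {T} → Pos T
  left  : ∀ {l r} → Pos l → Pos (node l r)
  right : ∀ {l r} → Pos r → Pos (node l r)

module _ {n : ℕ} where

  private variable
    T l r : Tree n

  sub : Pos T → Tree n
  sub {T} here  = T
  sub (left p)  = sub p
  sub (right p) = sub p

  parent : Pos T → Maybe (Pos T)
  parent here      = nothing
  -- If `p` has no parent within the left subtree, it is the root of that subtree and hangs from the
  -- root of the whole tree.
  parent (left p)  = just (Maybe.maybe left here (parent p))
  parent (right p) = just (Maybe.maybe right here (parent p))

  children : Pos T → List (Pos T)
  children {leaf _}   here      = []
  children {node _ _} here      = left here ∷ right here ∷ []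
  children            (left p)  = map left (children p)
  children            (right p) = map right (children p)

  -- The ancestor relation, each position counting as its own ancestor.
  data _⊑_ : Pos T → Pos T → Set where
    here  : ∀ {q : Pos T} → here ⊑ q
    left  : ∀ {p q : Pos l} → p ⊑ q → left {r = r} p ⊑ left q
    right : ∀ {p q : Pos r} → p ⊑ q → right {l = l} p ⊑ right q

  ⊑-refl : (p : Pos T) → p ⊑ p
  ⊑-refl here      = here
  ⊑-refl (left p)  = left (⊑-refl p)
  ⊑-refl (right p) = right (⊑-refl p)

  ⊑-trans : ∀ {p q s : Pos T} → p ⊑ q → q ⊑ s → p ⊑ s
  ⊑-trans here       _         = here
  ⊑-trans (left p⊑)  (left q⊑)  = left (⊑-trans p⊑ q⊑)
  ⊑-trans (right p⊑) (right q⊑) = right (⊑-trans p⊑ q⊑)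

  left-injective : ∀ {p q : Pos l} → left {r = r} p ≡ left q → p ≡ q
  left-injective refl = refl

  right-injective : ∀ {p q : Pos r} → right {l = l} p ≡ right q → p ≡ q
  right-injective refl = refl

  parent-⊑ : ∀ {q q′ : Pos T} → parent q ≡ just q′ → q′ ⊑ q
  parent-⊑ {q = left q}  eq with parent q in eq′
  parent-⊑ {q = left q}  refl | nothing = here
  parent-⊑ {q = left q}  refl | just _  = left (parent-⊑ eq′)
  parent-⊑ {q = right q} eq with parent q in eq′
  parent-⊑ {q = right q} refl | nothing = here
  parent-⊑ {q = right q} refl | just _  = right (parent-⊑ eq′)

  ⋢-parent : ∀ {p p′ : Pos T} → parent p ≡ just p′ → ¬ p ⊑ p′
  ⋢-parent {p = left p}  eq p⊑ with parent p in eq′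
  ⋢-parent {p = left p}  refl (left p⊑)  | just _ = ⋢-parent eq′ p⊑
  ⋢-parent {p = right p} eq p⊑ with parent p in eq′
  ⋢-parent {p = right p} refl (right p⊑) | just _ = ⋢-parent eq′ p⊑

  ⊑-parent : ∀ {p q : Pos T} → p ⊑ q → q ≡ p ⊎ (∃[ q′ ] parent q ≡ just q′ × p ⊑ q′)
  ⊑-parent {q = here}    here = inj₁ refl
  ⊑-parent {q = left q}  here = inj₂ (_ , refl , here)
  ⊑-parent {q = right q} here = inj₂ (_ , refl , here)
  ⊑-parent (left p⊑q) with ⊑-parent p⊑q
  ... | inj₁ refl = inj₁ refl
  ... | inj₂ (q′ , eq , p⊑q′) rewrite eq = inj₂ (_ , refl , left p⊑q′)
  ⊑-parent (right p⊑q) with ⊑-parent p⊑q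
  ... | inj₁ refl = inj₁ refl
  ... | inj₂ (q′ , eq , p⊑q′) rewrite eq = inj₂ (_ , refl , right p⊑q′)

  parent-nothing : ∀ {p : Pos T} → parent p ≡ nothing → p ≡ here
  parent-nothing {p = here} _ = refl

  ∈-children⁻ : ∀ {p q : Pos T} → q ∈ₗ children p → parent q ≡ just p
  ∈-children⁻ {node _ _} {here} (here refl)         = refl
  ∈-children⁻ {node _ _} {here} (there (here refl)) = refl
  ∈-children⁻ {p = left p}  q∈ with ∈-map⁻ left q∈
  ... | _ , q′∈ , refl rewrite ∈-children⁻ q′∈ = refl
  ∈-children⁻ {p = right p} q∈ with ∈-map⁻ right q∈
  ... | _ , q′∈ , refl rewrite ∈-children⁻ q′∈ = refl

  ∈-children⁺ : ∀ {p q : Pos T} → parent q ≡ just p → q ∈ₗ children p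
  ∈-children⁺ {q = left q} eq with parent q in eq′
  ∈-children⁺ {q = left q} refl | nothing rewrite parent-nothing eq′ = here refl
  ∈-children⁺ {q = left q} refl | just p  = ∈-map⁺ left (∈-children⁺ eq′)
  ∈-children⁺ {q = right q} eq with parent q in eq′
  ∈-children⁺ {q = right q} refl | nothing rewrite parent-nothing eq′ = there (here refl)
  ∈-children⁺ {q = right q} refl | just p  = ∈-map⁺ right (∈-children⁺ eq′)

  children-unique : ∀ (p : Pos T) → Unique (children p)
  children-unique {leaf _}   here = []
  children-unique {node _ _} here = ((λ ()) ∷ []) ∷ [] ∷ []
  children-unique (left p)  = Unique.map⁺ left-injective (children-unique p)
  children-unique (right p) = Unique.map⁺ right-injective (children-unique p)

  children-leaf : ∀ (p : Pos T) {x} → sub p ≡ leaf x → length (children p) ≡ 0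
  children-leaf here      refl = refl
  children-leaf (left p)  eq   = trans (length-map left (children p)) (children-leaf p eq)
  children-leaf (right p) eq   = trans (length-map right (children p)) (children-leaf p eq)

  children-node : ∀ (p : Pos T) {l r} → sub p ≡ node l r → length (children p) ≡ 2
  children-node here      refl = refl
  children-node (left p)  eq   = trans (length-map left (children p)) (children-node p eq)
  children-node (right p) eq   = trans (length-map right (children p)) (children-node p eq)

  ancestors : (q : Pos T) → Star (λ a b → parent b ≡ just a × b ⊑ q) here q
  ancestors here      = ε
  ancestors (left q)  = (refl , left here) ◅
    Star.gmap left (λ (eq , b⊑) → cong (just ∘ Maybe.maybe left here) eq , left b⊑) (ancestors q)
  ancestors (right q) = (refl , right here) ◅
    Star.gmap right (λ (eq , b⊑) → cong (just ∘ Maybe.maybe right here) eq , right b⊑) (ancestors q)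

  descend : ∀ {p q : Pos T} → p ⊑ q → Star (λ a b → parent b ≡ just a × p ⊑ a) p q
  descend {q = q} here = Star.map (λ (eq , _) → eq , here) (ancestors q)
  descend (left p⊑q)  =
    Star.gmap left (λ (eq , p⊑) → cong (just ∘ Maybe.maybe left here) eq , left p⊑) (descend p⊑q)
  descend (right p⊑q) =
    Star.gmap right (λ (eq , p⊑) → cong (just ∘ Maybe.maybe right here) eq , right p⊑) (descend p⊑q)

  ⟦sub⟧-anti : ∀ {p q : Pos T} → p ⊑ q → ⟦ sub q ⟧ ⊆ ⟦ sub p ⟧
  ⟦sub⟧-anti {q = here}    here x∈ = x∈
  ⟦sub⟧-anti {q = left q}  here x∈ = x∈p∪q⁺ (inj₁ (⟦sub⟧-anti {p = here} {q} here x∈))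
  ⟦sub⟧-anti {q = right q} here x∈ = x∈p∪q⁺ (inj₂ (⟦sub⟧-anti {p = here} {q} here x∈))
  ⟦sub⟧-anti (left p⊑q)  = ⟦sub⟧-anti p⊑q
  ⟦sub⟧-anti (right p⊑q) = ⟦sub⟧-anti p⊑q

  locate : ∀ (p : Pos T) {x} → x ∈ ⟦ sub p ⟧ → ∃[ q ] p ⊑ q × sub q ≡ leaf x
  locate {leaf y} here x∈ = here , here , cong leaf (sym (x∈⁅y⁆⇒x≡y y x∈))
  locate {node l r} here x∈ with x∈p∪q⁻ ⟦ l ⟧ ⟦ r ⟧ x∈
  ... | inj₁ x∈l = let q , _ , eq = locate {l} here x∈l in left q , here , eq
  ... | inj₂ x∈r = let q , _ , eq = locate {r} here x∈r in right q , here , eq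
  locate (left p)  x∈ = let q , p⊑q , eq = locate p x∈ in left q , left p⊑q , eq
  locate (right p) x∈ = let q , p⊑q , eq = locate p x∈ in right q , right p⊑q , eq

  leaf∈ : ∀ (p : Pos T) {x} → sub p ≡ leaf x → x ∈ ⟦ T ⟧
  leaf∈ p {x} eq = ⟦sub⟧-anti {p = here} {p} here (subst (λ S → x ∈ ⟦ S ⟧) (sym eq) (x∈⁅x⁆ x))

  leaf-unique : Proper T → ∀ (p q : Pos T) {x} → sub p ≡ leaf x → sub q ≡ leaf x → p ≡ q
  leaf-unique {leaf _}   _ here here _ _ = refl
  leaf-unique {node _ _} (disj , pl , pr) (left p)  (left q)  p≡x q≡x = cong left (leaf-unique pl p q p≡x q≡x)
  leaf-unique {node _ _} (disj , pl , pr) (right p) (right q) p≡x q≡x = cong right (leaf-unique pr p q p≡x q≡x)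
  leaf-unique {node _ _} (disj , pl , pr) (left p)  (right q) p≡x q≡x = contradiction (leaf∈ q q≡x) (disj _ (leaf∈ p p≡x))
  leaf-unique {node _ _} (disj , pl , pr) (right p) (left q)  p≡x q≡x = contradiction (leaf∈ p p≡x) (disj _ (leaf∈ q q≡x))

  sub∈sets : ∀ (p : Pos T) → ⟦ sub p ⟧ ∈ₗ sets T
  sub∈sets {leaf _}   here = here refl
  sub∈sets {node _ _} here = here refl
  sub∈sets (left p)                     = there (there (∈-++⁺ˡ (sub∈sets p)))
  sub∈sets {T = node l r} (right p) = there (there (∈-++⁺ʳ (sets l) (sub∈sets p)))

  ∁sub∈sets : ∀ (p : Pos T) → ∁ ⟦ sub p ⟧ ∈ₗ sets T
  ∁sub∈sets {leaf _}   here = there (here refl)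
  ∁sub∈sets {node _ _} here = there (here refl)
  ∁sub∈sets (left p)                     = there (there (∈-++⁺ˡ (∁sub∈sets p)))
  ∁sub∈sets {T = node l r} (right p) = there (there (∈-++⁺ʳ (sets l) (∁sub∈sets p)))

  everywhere : ∀ {P : Subset n → Set} T → (∀ (p : Pos T) → P ⟦ sub p ⟧) → Everywhere P T
  everywhere (leaf x)   h = h here
  everywhere (node l r) h = h here , everywhere l (h ∘ left) , everywhere r (h ∘ right)

  card : Tree n → ℕ
  card (leaf _)   = 1
  card (node l r) = suc (card l + card r)

  enc : Pos T → Fin (card T)
  enc {leaf _}   here  = zero
  enc {node _ _} here  = zero
  enc {node l r} (left p)  = suc (enc p ↑ˡ card r)
  enc {node l r} (right p) = suc (card l ↑ʳ enc p)

  dec : ∀ T → Fin (card T) → Pos T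
  dec (leaf _)   _       = here
  dec (node l r) zero    = here
  dec (node l r) (suc i) = [ left ∘ dec l , right ∘ dec r ]′ (splitAt (card l) i)

  dec-enc : ∀ (p : Pos T) → dec T (enc p) ≡ p
  dec-enc {leaf _}   here = refl
  dec-enc {node _ _} here = refl
  dec-enc {node l r} (left p)
    rewrite splitAt-↑ˡ (card l) (enc p) (card r) = cong left (dec-enc p)
  dec-enc {node l r} (right p)
    rewrite splitAt-↑ʳ (card l) (card r) (enc p) = cong right (dec-enc p)

  enc-dec : ∀ T (i : Fin (card T)) → enc (dec T i) ≡ i
  enc-dec (leaf _)   zero = refl
  enc-dec (node l r) zero = refl
  enc-dec (node l r) (suc i) with splitAt (card l) i in eq
  ... | inj₁ j = cong suc (trans (cong (_↑ˡ card r) (enc-dec l j)) (splitAt⁻¹-↑ˡ eq))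
  ... | inj₂ j = cong suc (trans (cong (card l ↑ʳ_) (enc-dec r j)) (splitAt⁻¹-↑ʳ eq))

∣tabulate∣ : ∀ {n} {P : Fin n → Bool} {xs} → Unique xs → (∀ {x} → P x ≡ true ⇔ x ∈ₗ xs) →
             ∣ tabulate P ∣ ≡ length xs
∣tabulate∣ {P = P} uniq P⇔ = trans (sym (length-trues P)) (≤-antisym
  (unique⇒length≤ (trues-unique P) (to P⇔ ∘ ∈-trues⁻ P))
  (unique⇒length≤ uniq (∈-trues⁺ P ∘ from P⇔)))

module _ {n} (G : Graph n) where
  open Graph G

  -- Reduces acyclicity to the claim that removing any edge separates its ends, which an invariant
  -- of walks can settle.
  cycle⇒detour : Cycle → ∃₂ λ x y → Adj x y × Star (AdjWithout x y) y x
  cycle⇒detour (x , y ∷ [] , s≤s () , _)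
  cycle⇒detour (x , y ∷ z ∷ zs , _ , (x≢y ∷ x≢z ∷ x∉) ∷ (y≢z ∷ y∉) ∷ _ , xy ∷ yz ∷ linked) =
    x , y , xy , (yz , (λ { (inj₁ (y≡x , _)) → x≢y (sym y≡x) ; (inj₂ (_ , z≡x)) → x≢z (sym z≡x) })) ◅
                 onward zs linked (y≢z ∷ y∉)
    where
    onward : ∀ {z} zs → Linked Adj (z ∷ zs ++ [ x ]) → All (y ≢_) (z ∷ zs) → Star (AdjWithout x y) z x
    onward []       (zx ∷ [-])    (y≢z ∷ [])         =
      (zx , (λ { (inj₁ (_ , x≡y)) → x≢y x≡y ; (inj₂ (z≡y , _)) → y≢z (sym z≡y) })) ◅ ε
    onward (w ∷ zs) (zw ∷ linked) (y≢z ∷ y≢w ∷ y∉) =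
      (zw , (λ { (inj₁ (_ , w≡y)) → y≢w (sym w≡y) ; (inj₂ (z≡y , _)) → y≢z (sym z≡y) })) ◅
      onward zs linked (y≢w ∷ y∉)

-- The tree T with one more vertex above its root, which becomes the leaf labelled zero.
module Planting {n} (T : Tree (suc n)) (proper : Proper T) (full : ∀ x → x ∈ ⟦ T ⟧ ⇔ x ≢ zero) where

  size : ℕ
  size = suc (card T)

  E : Maybe (Pos T) → Fin size
  E nothing  = zero
  E (just p) = suc (enc p)

  E⁻¹ : Fin size → Maybe (Pos T)
  E⁻¹ zero    = nothing
  E⁻¹ (suc i) = just (dec T i)

  E⁻¹-E : ∀ v → E⁻¹ (E v) ≡ v
  E⁻¹-E nothing  = refl
  E⁻¹-E (just p) = cong just (dec-enc p)

  E-E⁻¹ : ∀ i → E (E⁻¹ i) ≡ i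
  E-E⁻¹ zero    = refl
  E-E⁻¹ (suc i) = cong suc (enc-dec T i)

  E-injective : ∀ {u v} → E u ≡ E v → u ≡ v
  E-injective {u} {v} eq = trans (sym (E⁻¹-E u)) (trans (cong E⁻¹ eq) (E⁻¹-E v))

  isParent : Maybe (Pos T) → Maybe (Pos T) → Bool
  isParent u nothing  = false
  isParent u (just p) = does (E u Fin.≟ E (parent p))

  dn up : Pos T → Fin size
  dn p = E (just p)
  up p = E (parent p)

  isParent⁻ : ∀ {i j} → isParent (E⁻¹ i) (E⁻¹ j) ≡ true → ∃[ p ] i ≡ up p × j ≡ dn p
  isParent⁻ {i} {suc j} eq =
    dec T j , trans (sym (E-E⁻¹ i)) (does-true (E (E⁻¹ i) Fin.≟ _) eq) , sym (E-E⁻¹ (suc j))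

  isParent⁺ : ∀ p → isParent (E⁻¹ (up p)) (E⁻¹ (dn p)) ≡ true
  isParent⁺ p = trans (cong₂ isParent (E⁻¹-E (parent p)) (E⁻¹-E (just p))) (dec-true (up p Fin.≟ up p) refl)

  adj : Fin size → Fin size → Bool
  adj i j = isParent (E⁻¹ i) (E⁻¹ j) ∨ isParent (E⁻¹ j) (E⁻¹ i)

  edge : ∀ {i j} → adj i j ≡ true → ∃[ p ] (i ≡ up p × j ≡ dn p ⊎ i ≡ dn p × j ≡ up p)
  edge {i} {j} = ∨-elim (isParent (E⁻¹ i) (E⁻¹ j))
    (λ eq → let p , i≡ , j≡ = isParent⁻ {i} {j} eq in p , inj₁ (i≡ , j≡))
    (λ eq → let p , j≡ , i≡ = isParent⁻ {j} {i} eq in p , inj₂ (i≡ , j≡))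

  parent≢just : ∀ (p : Pos T) → parent p ≢ just p
  parent≢just p eq = ⋢-parent eq (⊑-refl p)

  tree : Graph size
  tree = record
    { adj       = adj
    ; symmetric = λ u v → ∨-comm (isParent (E⁻¹ u) (E⁻¹ v)) _
    ; loopless  = λ v → ¬-not λ vv → case edge {v} {v} vv of λ
        { (p , inj₁ (eq , eq′)) → parent≢just p (E-injective (trans (sym eq) eq′))
        ; (p , inj₂ (eq , eq′)) → parent≢just p (E-injective (trans (sym eq′) eq)) }
    }

  open Graph tree using (Adj; AdjWithout; Connected; Cycle; IsTree; degree; Leaf)

  up-dn : ∀ p → Adj (up p) (dn p)
  up-dn p = cong (_∨ isParent (E⁻¹ (dn p)) (E⁻¹ (up p))) (isParent⁺ p)

  adj-sym : ∀ {i j} → Adj i j → Adj j i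
  adj-sym {i} {j} ij = trans (Graph.symmetric tree j i) ij

  dn-up : ∀ p → Adj (dn p) (up p)
  dn-up p = adj-sym {up p} (up-dn p)

  child : ∀ {a b} → parent b ≡ just a → Adj (dn a) (dn b)
  child {a} {b} eq = subst (λ v → Adj (E v) (dn b)) eq (up-dn b)

  -- The only edge leaving this set joins `dn p` to `up p`. This one invariant gives both acyclicity
  -- and the sets displayed by the edges.
  Below : Pos T → Fin size → Set
  Below p i = ∃[ q ] i ≡ dn q × p ⊑ q

  dn-injective : ∀ {p q} → dn p ≡ dn q → p ≡ q
  dn-injective eq = just-injective (E-injective eq)

  ¬below-up : ∀ p → ¬ Below p (up p)
  ¬below-up p (q , eq , p⊑q) = ⋢-parent (E-injective eq) p⊑q

  below-step : ∀ {p i j} → Adj i j → ¬ (i ≡ dn p × j ≡ up p) → Below p i → Below p j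
  below-step {p} {i} {j} ij ≢ (q , i≡ , p⊑q) with edge {i} {j} ij
  ... | s , inj₁ (i≡up , j≡dn) =
    s , j≡dn , ⊑-trans p⊑q (parent-⊑ (E-injective (trans (sym i≡up) i≡)))
  ... | s , inj₂ (i≡dn , j≡up) with dn-injective (trans (sym i≡) i≡dn)
  ...   | refl with ⊑-parent p⊑q
  ...     | inj₁ refl = contradiction (i≡ , j≡up) ≢
  ...     | inj₂ (q′ , eq , p⊑q′) = q′ , trans j≡up (cong E eq) , p⊑q′

  below-walk : ∀ {p i j} → Star (AdjWithout (dn p) (up p)) i j → Below p i → Below p j
  below-walk ε = id
  below-walk (_◅_ {i} {j} (ij , ≢) s) = below-walk s ∘ below-step {i = i} {j} ij (≢ ∘ inj₁)

  above-walk : ∀ {p i j} → Star (AdjWithout (up p) (dn p)) i j → Below p j → Below p i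
  above-walk ε = id
  above-walk (_◅_ {i} {j} (ij , ≢) s) =
    below-step {i = j} {i} (adj-sym {i} {j} ij) (λ (j≡ , i≡) → ≢ (inj₁ (i≡ , j≡))) ∘ above-walk s

  from-root : ∀ {R : Fin size → Fin size → Set} q →
    R zero (dn here) → (∀ {a b} → parent b ≡ just a → b ⊑ q → R (dn a) (dn b)) → Star R zero (dn q)
  from-root q first steps = first ◅ Star.gmap dn (λ (eq , b⊑q) → steps eq b⊑q) (ancestors q)

  reach : ∀ i → Star Adj zero i
  reach i = subst (Star Adj zero) (E-E⁻¹ i) (reachE (E⁻¹ i))
    where
    reachE : ∀ v → Star Adj zero (E v)
    reachE nothing  = ε
    reachE (just q) = from-root q (up-dn here) (λ eq _ → child eq)

  isTree : IsTree
  isTree = (λ i j → Star.reverse (λ {a} {b} → adj-sym {a} {b}) (reach i) ◅◅ reach j) , acyclic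
    where
    acyclic : ¬ Cycle
    acyclic cycle with cycle⇒detour tree cycle
    ... | x , y , xy , y⋯x with edge {x} {y} xy
    ...   | p , inj₁ (refl , refl) =
      ¬below-up p (below-walk (Star.map (λ (ij , ≢) → ij , ≢ ∘ Sum.swap) y⋯x) (p , refl , ⊑-refl p))
    ...   | p , inj₂ (refl , refl) =
      ¬below-up p (above-walk (Star.map (λ (ij , ≢) → ij , ≢ ∘ Sum.swap) y⋯x) (p , refl , ⊑-refl p))

  below⇔ : ∀ p i → Star (AdjWithout (dn p) (up p)) (dn p) i ⇔ Below p i
  below⇔ p i = mk⇔ (λ s → below-walk s (p , refl , ⊑-refl p)) λ { (q , refl , p⊑q) →
    Star.gmap dn (λ {a} {b} (eq , p⊑a) → child eq , λ
      { (inj₁ (_ , dn≡up)) → ⋢-parent (sym (E-injective dn≡up)) (⊑-trans p⊑a (parent-⊑ eq))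
      ; (inj₂ (dn≡up , _)) → ⋢-parent (sym (E-injective dn≡up)) p⊑a }) (descend p⊑q) }

  -- A vertex that is not below `p` has no ancestor at `p`, so its walk from the root keeps clear of
  -- `dn p`. The same holds for `up p`, and the two walks meet at the root.
  above⇔ : ∀ p i → Star (AdjWithout (up p) (dn p)) (up p) i ⇔ (¬ Below p i)
  above⇔ p i = mk⇔ (λ s below → ¬below-up p (above-walk s below))
    (λ ¬below → Star.reverse without-sym (root⋯ (up p) (¬below-up p)) ◅◅ root⋯ i ¬below)
    where
    W = AdjWithout (up p) (dn p)
    without-sym : ∀ {a b} → W a b → W b a
    without-sym {a} {b} (ab , ≢) = adj-sym {a} {b} ab , λ
      { (inj₁ (x , y)) → ≢ (inj₂ (y , x)) ; (inj₂ (x , y)) → ≢ (inj₁ (y , x)) }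

    off : ∀ {a b} → Adj a b → a ≢ dn p → b ≢ dn p → W a b
    off ab a≢ b≢ = ab , λ { (inj₁ (_ , eq)) → b≢ eq ; (inj₂ (eq , _)) → a≢ eq }

    root⋯E : ∀ v → ¬ Below p (E v) → Star W zero (E v)
    root⋯E nothing  _      = ε
    root⋯E (just q) ¬below = from-root q
      (off (up-dn here) (λ ()) λ eq → p⋢q (subst (_⊑ q) (dn-injective eq) here))
      (λ {a} {b} eq b⊑q → off (child eq)
        (λ a≡ → p⋢q (subst (_⊑ q) (dn-injective a≡) (⊑-trans (parent-⊑ eq) b⊑q)))
        (λ b≡ → p⋢q (subst (_⊑ q) (dn-injective b≡) b⊑q)))
      where
      p⋢q : ¬ p ⊑ q
      p⋢q p⊑q = ¬below (q , refl , p⊑q)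

    root⋯ : ∀ i → ¬ Below p i → Star W zero i
    root⋯ i ¬below = subst (Star W zero) (E-E⁻¹ i) (root⋯E (E⁻¹ i) (¬below ∘ subst (Below p) (E-E⁻¹ i)))

  nbrs : Maybe (Pos T) → List (Maybe (Pos T))
  nbrs nothing  = just here ∷ []
  nbrs (just p) = parent p ∷ map just (children p)

  nbrs-unique : ∀ v → Unique (nbrs v)
  nbrs-unique nothing  = [] ∷ []
  nbrs-unique (just p) = All.tabulate parent∉ ∷ Unique.map⁺ just-injective (children-unique p)
    where
    parent∉ : ∀ {v} → v ∈ₗ map just (children p) → parent p ≢ v
    parent∉ v∈ eq with ∈-map⁻ just v∈
    ... | c , c∈ , refl = ⋢-parent eq (parent-⊑ (∈-children⁻ c∈))

  nbrs-adj : ∀ v {j} → Adj (E v) j ⇔ j ∈ₗ map E (nbrs v)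
  nbrs-adj v {j} = mk⇔ (λ vj → adj⇒ v (edge {E v} {j} vj)) (λ j∈ → case ∈-map⁻ E j∈ of λ { (w , w∈ , refl) → ⇒adj v w∈ })
    where
    adj⇒ : ∀ v → ∃[ p ] (E v ≡ up p × j ≡ dn p ⊎ E v ≡ dn p × j ≡ up p) → j ∈ₗ map E (nbrs v)
    adj⇒ nothing  (p , inj₁ (eq , refl)) rewrite parent-nothing (sym (E-injective {nothing} {parent p} eq)) = here refl
    adj⇒ (just q) (p , inj₁ (eq , refl)) =
      there (∈-map⁺ E (∈-map⁺ just (∈-children⁺ (sym (E-injective {just q} {parent p} eq)))))
    adj⇒ (just q) (p , inj₂ (eq , refl)) with dn-injective {q} {p} eq
    ... | refl = here refl
    ⇒adj : ∀ v {w} → w ∈ₗ nbrs v → Adj (E v) (E w)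
    ⇒adj nothing  (here refl) = up-dn here
    ⇒adj (just p) (here refl) = dn-up p
    ⇒adj (just p) (there w∈) with ∈-map⁻ just w∈
    ... | c , c∈ , refl = child (∈-children⁻ c∈)

  degree-E : ∀ v → degree (E v) ≡ length (nbrs v)
  degree-E v = trans (∣tabulate∣ (Unique.map⁺ E-injective (nbrs-unique v)) (nbrs-adj v)) (length-map E (nbrs v))

  degree-leaf : ∀ p {x} → sub p ≡ leaf x → degree (dn p) ≡ 1
  degree-leaf p eq = trans (degree-E (just p))
    (cong suc (trans (length-map just (children p)) (children-leaf p eq)))

  degree-node : ∀ p {l r} → sub p ≡ node l r → degree (dn p) ≡ 3
  degree-node p eq = trans (degree-E (just p))
    (cong suc (trans (length-map just (children p)) (children-node p eq)))

  cubic : ∀ i → degree i ≢ 1 → degree i ≡ 3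
  cubic i = subst (λ i → degree i ≢ 1 → degree i ≡ 3) (E-E⁻¹ i) (cubicE (E⁻¹ i))
    where
    cubicE : ∀ v → degree (E v) ≢ 1 → degree (E v) ≡ 3
    cubicE nothing  ≢1 = contradiction (degree-E nothing) ≢1
    cubicE (just p) ≢1 with sub p in eq
    ... | leaf x   = contradiction (degree-leaf p eq) ≢1
    ... | node l r = degree-node p eq

  position : ∀ y → ∃[ q ] sub {T = T} q ≡ leaf (suc y)
  position y = let q , _ , eq = locate {T = T} here (from (full (suc y)) λ ()) in q , eq

  labelᵀ : Tree (suc n) → Fin (suc n)
  labelᵀ (leaf x)   = x
  -- A dummy value: internal positions have degree 3 and so are not leaves.
  labelᵀ (node _ _) = zero

  label : Maybe (Pos T) → Fin (suc n)
  label nothing  = zero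
  label (just p) = labelᵀ (sub p)

  leafOf : Fin (suc n) → Leaf
  leafOf zero    = zero , degree-E nothing
  leafOf (suc y) = let q , eq = position y in dn q , degree-leaf q eq

  leaves : Leaf ↔ Fin (suc n)
  leaves = mk↔ₛ′ (λ (i , _) → label (E⁻¹ i)) leafOf label-leafOf leafOf-label
    where
    label-leafOf : ∀ x → label (E⁻¹ (proj₁ (leafOf x))) ≡ x
    label-leafOf zero    = refl
    label-leafOf (suc y) = let q , eq = position y in
      trans (cong label (E⁻¹-E (just q))) (cong labelᵀ eq)

    same : ∀ (s t : Leaf) → proj₁ s ≡ proj₁ t → s ≡ t
    same (i , p) (_ , q) refl = cong (i ,_) (≡-irrelevant p q)

    at : ∀ v → degree (E v) ≡ 1 → proj₁ (leafOf (label v)) ≡ E v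
    at nothing  _   = refl
    at (just p) ≡1 with sub p in eq
    ... | node l r = contradiction (trans (sym ≡1) (degree-node p eq)) λ ()
    ... | leaf zero = contradiction refl (to (full zero) (leaf∈ p eq))
    ... | leaf (suc y) = let q , eq′ = position y in cong dn (leaf-unique proper q p eq′ eq)

    leafOf-label : ∀ s → leafOf (label (E⁻¹ (proj₁ s))) ≡ s
    leafOf-label s@(i , d) = same _ s
      (trans (at (E⁻¹ i) (subst (λ i → degree i ≡ 1) (sym (E-E⁻¹ i)) d)) (E-E⁻¹ i))

  decomposition : BranchDecomposition (suc n)
  decomposition = record
    { size = size ; tree = tree ; isTree = isTree ; cubic = cubic ; leaves = leaves }

  open BranchDecomposition decomposition using (Displayed; leafAt)

  below-leafAt : ∀ p x → Below p (leafAt x) ⇔ x ∈ ⟦ sub p ⟧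
  below-leafAt p zero = mk⇔ (λ { (_ , () , _) })
    (λ 0∈ → contradiction refl (to (full zero) (⟦sub⟧-anti {p = here} {p} here 0∈)))
  below-leafAt p (suc y) = mk⇔
    (λ (q , eq , p⊑q) → ⟦sub⟧-anti (subst (p ⊑_) (sym (dn-injective eq)) p⊑q)
                          (subst (λ S → suc y ∈ ⟦ S ⟧) (sym (proj₂ (position y))) (x∈⁅x⁆ (suc y))))
    (λ x∈ → let q , p⊑q , eq = locate p x∈ in
      q , cong dn (leaf-unique proper _ q (proj₂ (position y)) eq) , p⊑q)

  displayed-sub : ∀ p → Displayed ⟦ sub p ⟧
  displayed-sub p = dn p , up p , dn-up p , λ x →
    mk⇔ (from (below⇔ p _) ∘ from (below-leafAt p x)) (to (below-leafAt p x) ∘ to (below⇔ p _))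

  displayed-∁sub : ∀ p → Displayed (∁ ⟦ sub p ⟧)
  displayed-∁sub p = up p , dn p , up-dn p , λ x → mk⇔
    (λ x∈ → from (above⇔ p _) λ below → x∈∁p⇒x∉p x∈ (to (below-leafAt p x) below))
    (λ s → x∉p⇒x∈∁p λ x∈ → to (above⇔ p _) s (from (below-leafAt p x) x∈))

  same-set : ∀ {A B : Subset (suc n)} → (∀ x → x ∈ A ⇔ x ∈ B) → A ≡ B
  same-set A⇔B = ⊆-antisym (λ {x} → to (A⇔B x)) (λ {x} → from (A⇔B x))

  displayed⇒sets : ∀ {A} → Displayed A → A ∈ₗ sets T
  displayed⇒sets (u , v , uv , corr) with edge {u} {v} uv
  ... | p , inj₁ (refl , refl) = subst (_∈ₗ sets T) (same-set λ x →
    mk⇔ (from (corr x) ∘ to (proj₂ (proj₂ (proj₂ (displayed-∁sub p))) x))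
        (from (proj₂ (proj₂ (proj₂ (displayed-∁sub p))) x) ∘ to (corr x))) (∁sub∈sets p)
  ... | p , inj₂ (refl , refl) = subst (_∈ₗ sets T) (same-set λ x →
    mk⇔ (from (corr x) ∘ to (proj₂ (proj₂ (proj₂ (displayed-sub p))) x))
        (from (proj₂ (proj₂ (proj₂ (displayed-sub p))) x) ∘ to (corr x))) (sub∈sets p)

  sets⇒displayed : ∀ {A} → A ∈ₗ sets T → Displayed A
  sets⇒displayed = everywhere⇒sets T (everywhere T λ p → displayed-sub p , displayed-∁sub p)

-- Branch-width is attained

∣p∪q∣≤∣p∣+∣q∣ : ∀ {n} (p q : Subset n) → ∣ p ∪ q ∣ ≤ ∣ p ∣ + ∣ q ∣
∣p∪q∣≤∣p∣+∣q∣ []          []          = z≤n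
∣p∪q∣≤∣p∣+∣q∣ (true ∷ p)  (true ∷ q)  = s≤s (≤-trans (∣p∪q∣≤∣p∣+∣q∣ p q) (+-monoʳ-≤ ∣ p ∣ (n≤1+n _)))
∣p∪q∣≤∣p∣+∣q∣ (true ∷ p)  (false ∷ q) = s≤s (∣p∪q∣≤∣p∣+∣q∣ p q)
∣p∪q∣≤∣p∣+∣q∣ (false ∷ p) (true ∷ q)  = ≤-trans (s≤s (∣p∪q∣≤∣p∣+∣q∣ p q)) (≤-reflexive (sym (+-suc ∣ p ∣ ∣ q ∣)))
∣p∪q∣≤∣p∣+∣q∣ (false ∷ p) (false ∷ q) = ∣p∪q∣≤∣p∣+∣q∣ p q

module _ {n : ℕ} where

  ⟦⟧-nonempty : (T : Tree n) → Nonempty ⟦ T ⟧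
  ⟦⟧-nonempty (leaf x)   = x , x∈⁅x⁆ x
  ⟦⟧-nonempty (node l r) = let x , x∈ = ⟦⟧-nonempty l in x , x∈p∪q⁺ (inj₁ x∈)

  proper? : (T : Tree n) → Dec (Proper T)
  proper? (leaf x)   = yes tt
  proper? (node l r) = all? (λ x → x ∈? ⟦ l ⟧ →-dec ¬? (x ∈? ⟦ r ⟧)) ×-dec proper? l ×-dec proper? r

  trees : ℕ → List (Tree n)
  trees zero    = []
  trees (suc d) = map leaf (allFin n) ++ cartesianProductWith node (trees d) (trees d)

  -- The two children of a proper node have disjoint nonempty label sets, so each has fewer labels
  -- than the node. The number of labels therefore bounds the depth.
  ∈-trees : ∀ T → Proper T → ∀ d → ∣ ⟦ T ⟧ ∣ ≤ d → T ∈ₗ trees d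
  ∈-trees (leaf x) _ zero ∣T∣≤ = contradiction (≤-trans (≤-reflexive (sym (∣⁅x⁆∣≡1 x))) ∣T∣≤) λ ()
  ∈-trees (leaf x) _ (suc d) _ = ∈-++⁺ˡ (∈-map⁺ leaf (∈-allFin x))
  ∈-trees (node l r) (disjoint , proper-l , proper-r) d ∣T∣≤ =
    go d (≤-trans (p⊂q⇒∣p∣<∣q∣ l⊂) ∣T∣≤) (≤-trans (p⊂q⇒∣p∣<∣q∣ r⊂) ∣T∣≤)
    where
    l⊂ : ⟦ l ⟧ ⊂ ⟦ l ⟧ ∪ ⟦ r ⟧
    l⊂ = p⊆p∪q ⟦ r ⟧ , let x , x∈r = ⟦⟧-nonempty r in
      x , q⊆p∪q ⟦ l ⟧ ⟦ r ⟧ x∈r , λ x∈l → disjoint x x∈l x∈r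
    r⊂ : ⟦ r ⟧ ⊂ ⟦ l ⟧ ∪ ⟦ r ⟧
    r⊂ = q⊆p∪q ⟦ l ⟧ ⟦ r ⟧ , let x , x∈l = ⟦⟧-nonempty l in
      x , p⊆p∪q ⟦ r ⟧ x∈l , λ x∈r → disjoint x x∈l x∈r
    go : ∀ d → ∣ ⟦ l ⟧ ∣ < d → ∣ ⟦ r ⟧ ∣ < d → node l r ∈ₗ trees d
    go (suc d) (s≤s l≤) (s≤s r≤) = ∈-++⁺ʳ (map leaf (allFin n))
      (∈-cartesianProductWith⁺ node (∈-trees l proper-l d l≤) (∈-trees r proper-r d r≤))

  -- Supplies the planted tree from which the minimisation over all planted trees starts.
  caterpillar : Fin n → List (Fin n) → Tree n
  caterpillar x []       = leaf x
  caterpillar x (y ∷ ys) = node (leaf x) (caterpillar y ys)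

  ∈-caterpillar : ∀ {z} x ys → z ∈ ⟦ caterpillar x ys ⟧ ⇔ z ∈ₗ x ∷ ys
  ∈-caterpillar {z} x [] = mk⇔ (λ z∈ → here (x∈⁅y⁆⇒x≡y x z∈)) λ { (here refl) → x∈⁅x⁆ x }
  ∈-caterpillar {z} x (y ∷ ys) = mk⇔
    (λ z∈ → [ (λ z∈x → here (x∈⁅y⁆⇒x≡y x z∈x)) , there ∘ to (∈-caterpillar y ys) ]′ (x∈p∪q⁻ ⁅ x ⁆ _ z∈))
    λ { (here refl) → x∈p∪q⁺ (inj₁ (x∈⁅x⁆ x)) ; (there z∈) → x∈p∪q⁺ (inj₂ (from (∈-caterpillar y ys) z∈)) }

  caterpillar-proper : ∀ x ys → Unique (x ∷ ys) → Proper (caterpillar x ys)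
  caterpillar-proper x []       _           = tt
  caterpillar-proper x (y ∷ ys) (x∉ ∷ uniq) =
    (λ z z∈x z∈ys → All.lookup x∉ (to (∈-caterpillar y ys) z∈ys) (sym (x∈⁅y⁆⇒x≡y x z∈x))) ,
    tt , caterpillar-proper y ys uniq

  -- A tree with more than two thirds of the labels has a child with at least one third; descend to
  -- it until at most two thirds remain. A leaf stops the descent because `3 ≤ 2 * n`.
  balanced-subtree : ∀ {P : Subset n → Set} T → 3 ≤ 2 * n → Everywhere P T → n ≤ 3 * ∣ ⟦ T ⟧ ∣ →
    ∃[ A ] P A × n ≤ 3 * ∣ A ∣ × 3 * ∣ A ∣ ≤ 2 * n
  balanced-subtree (leaf x) 3≤2n p n≤ =
    ⁅ x ⁆ , p , n≤ , ≤-trans (≤-reflexive (cong (3 *_) (∣⁅x⁆∣≡1 x))) 3≤2n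
  balanced-subtree (node l r) 3≤2n (p , every-l , every-r) n≤
    with 3 * ∣ ⟦ node l r ⟧ ∣ ≤? 2 * n | n ≤? 3 * ∣ ⟦ l ⟧ ∣ | n ≤? 3 * ∣ ⟦ r ⟧ ∣
  ... | yes ≤2n | _      | _      = _ , p , n≤ , ≤2n
  ... | no _    | yes n≤l | _      = balanced-subtree l 3≤2n every-l n≤l
  ... | no _    | no _   | yes n≤r = balanced-subtree r 3≤2n every-r n≤r
  ... | no ≰2n  | no n≰l | no n≰r = contradiction (begin
    3 * ∣ ⟦ l ⟧ ∪ ⟦ r ⟧ ∣          ≤⟨ *-monoʳ-≤ 3 (∣p∪q∣≤∣p∣+∣q∣ ⟦ l ⟧ ⟦ r ⟧) ⟩
    3 * (∣ ⟦ l ⟧ ∣ + ∣ ⟦ r ⟧ ∣)    ≡⟨ *-distribˡ-+ 3 ∣ ⟦ l ⟧ ∣ _ ⟩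
    3 * ∣ ⟦ l ⟧ ∣ + 3 * ∣ ⟦ r ⟧ ∣  ≤⟨ +-mono-≤ (<⇒≤ (≰⇒> n≰l)) (<⇒≤ (≰⇒> n≰r)) ⟩
    n + n                          ≡⟨ cong (n +_) (+-identityʳ n) ⟨
    2 * n                          ∎) ≰2n
    where open ≤-Reasoning

module _ {n : ℕ} where

  Planted : Tree (suc n) → Set
  Planted T = Proper T × ⟦ T ⟧ ≡ ∁ ⁅ zero ⁆

  planted? : ∀ (T : Tree (suc n)) → Dec (Planted T)
  planted? T = proper? T ×-dec ≡-dec Bool._≟_ ⟦ T ⟧ (∁ ⁅ zero ⁆)

  planted-full : ∀ (T : Tree (suc n)) → ⟦ T ⟧ ≡ ∁ ⁅ zero ⁆ → ∀ x → x ∈ ⟦ T ⟧ ⇔ x ≢ zero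
  planted-full T eq x rewrite eq = mk⇔
    (λ x∈ x≡0 → x∈∁p⇒x∉p x∈ (subst (_∈ ⁅ zero ⁆) (sym x≡0) (x∈⁅x⁆ zero)))
    (λ x≢0 → x∉p⇒x∈∁p (x≢0 ∘ x∈⁅y⁆⇒x≡y zero))

  full-planted : ∀ (T : Tree (suc n)) → (∀ x → x ∈ ⟦ T ⟧ ⇔ x ≢ zero) → ⟦ T ⟧ ≡ ∁ ⁅ zero ⁆
  full-planted T full = ⊆-antisym
    (λ {x} x∈ → x∉p⇒x∈∁p (to (full x) x∈ ∘ x∈⁅y⁆⇒x≡y zero))
    (λ {x} x∈ → from (full x) λ x≡0 → x∈∁p⇒x∉p x∈ (subst (_∈ ⁅ zero ⁆) (sym x≡0) (x∈⁅x⁆ zero)))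

-- Minimising the width over planted trees

module Width {W : Set} (key : W → ℕ) where

  -- Ranks are compared as they are and logarithms by their arguments, so both orders come from a
  -- key in ℕ, where maxima and minima of lists are available.
  _≲_ : W → W → Set
  x ≲ y = key x ≤ key y

  module _ {n : ℕ} (f : Subset (suc n) → W) where

    widest : Tree (suc n) → Subset (suc n)
    widest T = argmax (key ∘ f) ⟦ T ⟧ (sets T)

    widest∈sets : ∀ T → widest T ∈ₗ sets T
    widest∈sets T = argmax-all (key ∘ f) (sub∈sets {T = T} here) (All.tabulate id)

    sets≲widest : ∀ T {A} → A ∈ₗ sets T → f A ≲ f (widest T)
    sets≲widest T A∈ = All.lookup (f[xs]≤f[argmax] ⟦ T ⟧ (sets T)) A∈

    branchWidth : ∃ Planted → ∃[ w ] IsBranchWidth _≲_ f w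
    branchWidth (T₀ , planted₀) =
      f (widest T*) , (decomposition , (widest T* , sets⇒displayed (widest∈sets T*) , refl) ,
                       λ A shown → sets≲widest T* (displayed⇒sets shown)) ,
      least
      where
      candidates : List (Tree (suc n))
      candidates = filter planted? (trees (suc n))
      T* : Tree (suc n)
      T* = argmin (key ∘ f ∘ widest) T₀ candidates
      planted* : Planted T*
      planted* = argmin-all (key ∘ f ∘ widest) planted₀
        (All.tabulate λ T∈ → proj₂ (∈-filter⁻ planted? {xs = trees (suc n)} T∈))
      open Planting T* (proj₁ planted*) (planted-full T* (proj₂ planted*))

      -- Rooting `D` yields a candidate whose sets are all displayed by `D`, so even its widest set
      -- stays within the width of `D`.
      least : ∀ D w → IsWidth _≲_ f D w → f (widest T*) ≲ w
      least D w (_ , bound) with Rooting.rooted D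
      ... | T , proper , shown , full = ≤-trans
        (All.lookup (f[argmin]≤f[xs] T₀ candidates)
          (∈-filter⁺ planted? (∈-trees T proper (suc n) (∣p∣≤n ⟦ T ⟧)) (proper , full-planted T full)))
        (bound (widest T) (everywhere⇒sets T shown (widest∈sets T)))

    balanced : ∀ {w} → IsBranchWidth _≲_ f w → 3 ≤ suc n →
      ∃[ A ] suc n ≤ 3 * ∣ A ∣ × 3 * ∣ A ∣ ≤ 2 * suc n × f A ≲ w
    balanced ((D , _ , bound) , _) 3≤n with Rooting.rooted D
    ... | T , proper , shown , full
      with balanced-subtree T (≤-trans 3≤n (m≤m+n (suc n) _)) shown large
      where
      open ≤-Reasoning
      ∣T∣ : ∣ ⟦ T ⟧ ∣ ≡ n
      ∣T∣ = trans (cong ∣_∣ (full-planted T full)) (trans (∣∁p∣≡n∸∣p∣ (⁅ zero {n} ⁆)) (cong (suc n ∸_) (∣⁅x⁆∣≡1 (zero {n}))))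
      -- Only the label `zero` is missing, so the descent to a balanced subtree may start at the
      -- root.
      large : suc n ≤ 3 * ∣ ⟦ T ⟧ ∣
      large = begin
        suc n                   ≤⟨ +-monoˡ-≤ n (≤-trans (s≤s z≤n) (≤-pred 3≤n)) ⟩
        n + n                   ≤⟨ +-monoʳ-≤ n (m≤m+n n _) ⟩
        3 * n                   ≡⟨ cong (3 *_) ∣T∣ ⟨
        3 * ∣ ⟦ T ⟧ ∣           ∎
    ...   | A , (shown-A , _) , n≤ , ≤2n = A , n≤ , ≤2n , bound A shown-A

  branchWidth-exists : ∀ {n} → 3 ≤ n → (f : Subset n → W) → ∃[ w ] IsBranchWidth _≲_ f w
  branchWidth-exists {suc (suc n)} _ f = branchWidth f
    (T , caterpillar-proper (suc zero) (map suc (List.tabulate suc)) (Unique.map⁺ Fin.suc-injective (Unique.allFin⁺ (suc n))) , full-planted T full)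
    where
    T = caterpillar (suc zero) (map suc (List.tabulate suc))
    full : ∀ x → x ∈ ⟦ T ⟧ ⇔ x ≢ zero
    full x = mk⇔ (λ x∈ x≡0 → case ∈-map⁻ suc (to (∈-caterpillar (suc zero) (map suc (List.tabulate suc))) x∈) of λ { (_ , _ , eq) → contradiction (trans (sym x≡0) eq) λ () })
                 (λ x≢0 → from (∈-caterpillar (suc zero) (map suc (List.tabulate suc))) (nonzero x x≢0))
      where
      nonzero : ∀ x → x ≢ zero → x ∈ₗ map suc (allFin (suc n))
      nonzero zero    0≢0 = contradiction refl 0≢0
      nonzero (suc y) _   = ∈-map⁺ suc (∈-allFin y)
  branchWidth-exists {suc zero} (s≤s ()) f

  balanced-cut : ∀ {n} → 3 ≤ n → (f : Subset n → W) → ∀ {w} → IsBranchWidth _≲_ f w →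
    ∃[ A ] n ≤ 3 * ∣ A ∣ × 3 * ∣ A ∣ ≤ 2 * n × f A ≲ w
  balanced-cut {suc n} 3≤n f isWidth = balanced f isWidth 3≤n

-- The graph

all-false : ∀ {A : Set} (p : A → Bool) xs → all p xs ≡ false → ∃[ x ] x ∈ₗ xs × p x ≡ false
all-false p (x ∷ xs) eq with p x in px
... | false = x , here refl , px
... | true  = let y , y∈ , py = all-false p xs eq in y , there y∈ , py

-- Doubling instead of 2 ^ m makes the two halves of the cube consecutive in Fin.
pow : ℕ → ℕ
pow zero    = 1
pow (suc m) = pow m + pow m

pow≡2^ : ∀ m → pow m ≡ 2 ^ m
pow≡2^ zero    = refl
pow≡2^ (suc m) = trans (cong₂ _+_ (pow≡2^ m) (pow≡2^ m)) (2^suc m)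

vertex : Vec Bool m → Fin (pow m)
vertex         []          = zero
vertex {suc m} (false ∷ v) = vertex v ↑ˡ pow m
vertex {suc m} (true ∷ v)  = pow m ↑ʳ vertex v

vector : ∀ m → Fin (pow m) → Vec Bool m
vector zero    _ = []
vector (suc m) i = [ (false ∷_) ∘ vector m , (true ∷_) ∘ vector m ]′ (splitAt (pow m) i)

vector-vertex : ∀ (v : Vec Bool m) → vector m (vertex v) ≡ v
vector-vertex         []          = refl
vector-vertex {suc m} (false ∷ v) rewrite splitAt-↑ˡ (pow m) (vertex v) (pow m) = cong (false ∷_) (vector-vertex v)
vector-vertex {suc m} (true ∷ v)  rewrite splitAt-↑ʳ (pow m) (pow m) (vertex v) = cong (true ∷_) (vector-vertex v)

vertex-vector : ∀ m (i : Fin (pow m)) → vertex (vector m i) ≡ i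
vertex-vector zero    zero = refl
vertex-vector (suc m) i with splitAt (pow m) i in eq
... | inj₁ j = trans (cong (_↑ˡ pow m) (vertex-vector m j)) (splitAt⁻¹-↑ˡ eq)
... | inj₂ j = trans (cong (pow m ↑ʳ_) (vertex-vector m j)) (splitAt⁻¹-↑ʳ eq)

∣tabulate∣-+ : ∀ k {l} (P : Fin (k + l) → Bool) →
  ∣ tabulate P ∣ ≡ ∣ tabulate (P ∘ (_↑ˡ l)) ∣ + ∣ tabulate (P ∘ (k ↑ʳ_)) ∣
∣tabulate∣-+ zero    P = refl
∣tabulate∣-+ (suc k) P with P zero
... | true  = cong suc (∣tabulate∣-+ k (P ∘ suc))
... | false = ∣tabulate∣-+ k (P ∘ suc)

∣tabulate∣≡# : ∀ m (P : Fin (pow m) → Bool) → ∣ tabulate P ∣ ≡ # (P ∘ vertex {m})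
∣tabulate∣≡# zero P with P zero
... | true  = refl
... | false = refl
∣tabulate∣≡# (suc m) P = trans (∣tabulate∣-+ (pow m) P)
  (cong₂ _+_ (∣tabulate∣≡# m (P ∘ (_↑ˡ pow m))) (∣tabulate∣≡# m (P ∘ (pow m ↑ʳ_))))

vectorsIn : Subset (pow m) → Vec Bool m → Bool
vectorsIn A = lookup A ∘ vertex

∣∣≡#vectorsIn : ∀ (A : Subset (pow m)) → ∣ A ∣ ≡ # (vectorsIn {m} A)
∣∣≡#vectorsIn {m} A = trans (cong ∣_∣ (sym (tabulate∘lookup A))) (∣tabulate∣≡# m (lookup A))

elements-⊆ : ∀ {n} (A : Subset n) i → lookup (elements A) i ∈ A
elements-⊆ (true ∷ A)  zero    = Vec.here
elements-⊆ (true ∷ A)  (suc i) =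
  subst (_∈ true ∷ A) (sym (lookup-map i suc (elements A))) (Vec.there (elements-⊆ A i))
elements-⊆ (false ∷ A) i       =
  subst (_∈ false ∷ A) (sym (lookup-map i suc (elements A))) (Vec.there (elements-⊆ A i))

elements-⊇ : ∀ {n} (A : Subset n) {x} → x ∈ A → ∃[ i ] lookup (elements A) i ≡ x
elements-⊇ (true ∷ A)  Vec.here = zero , refl
elements-⊇ (true ∷ A)  (Vec.there x∈) with elements-⊇ A x∈
... | i , refl = suc i , lookup-map i suc (elements A)
elements-⊇ (false ∷ A) (Vec.there x∈) with elements-⊇ A x∈
... | i , refl = i , lookup-map i suc (elements A)

-- Loops are removed by clearing the diagonal, which no cut matrix meets.
dotGraph : ∀ m → Graph (pow m)
dotGraph m = record
  { adj       = λ i j → dot (vector m i) (vector m j) ∧ not (does (i Fin.≟ j))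
  ; symmetric = λ i j → cong₂ (λ x y → x ∧ not y) (dot-comm (vector m i) (vector m j)) (≟-sym i j)
  ; loopless  = λ i → trans (cong (λ b → dot (vector m i) (vector m i) ∧ not b) (dec-true (i Fin.≟ i) refl))
                            (Bool.∧-zeroʳ _)
  }
  where
  ≟-sym : ∀ (i j : Fin (pow m)) → does (i Fin.≟ j) ≡ does (j Fin.≟ i)
  ≟-sym i j with i Fin.≟ j
  ... | yes i≡j = sym (dec-true (j Fin.≟ i) (sym i≡j))
  ... | no  i≢j = sym (dec-false (j Fin.≟ i) (i≢j ∘ sym))

-- Cuts of the scalar product graph

module Cut {m} (A : Subset (pow m)) where
  open Graph (dotGraph m)

  inA outA : Vec Bool m → Bool
  inA  = vectorsIn A
  outA = vectorsIn (∁ A)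

  adj≡dot : ∀ {i j} → i ∈ A → j ∈ ∁ A → adj i j ≡ dot (vector m i) (vector m j)
  adj≡dot {i} {j} i∈ j∈ = trans
    (cong (λ b → dot (vector m i) (vector m j) ∧ not b)
      (dec-false (i Fin.≟ j) λ { refl → x∈∁p⇒x∉p j∈ i∈ }))
    (∧-identityʳ _)

  cutMatrix = adjacencyMatrix (dotGraph m) A (∁ A)

  rows : Fin ∣ A ∣ → Vec Bool m
  rows i = vector m (lookup (elements A) i)

  columns : Fin ∣ ∁ A ∣ → Vec Bool m
  columns j = vector m (lookup (elements (∁ A)) j)

  factor : ∀ i j → cutMatrix i j ≡ dot (rows i) (columns j)
  factor i j = adj≡dot (elements-⊆ A i) (elements-⊆ (∁ A) j)

  vectors-listed : ∀ (B : Subset (pow m)) v → vectorsIn B v ≡ true →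
                   ∃[ i ] vector m (lookup (elements B) i) ≡ v
  vectors-listed B v Bv = let i , eq = elements-⊇ B (lookup⇒∈ Bv) in
    i , trans (cong (vector m) eq) (vector-vertex v)

  rw≤m : rw (dotGraph m) A (∁ A) ≤ m
  rw≤m = rank≤dim cutMatrix rows columns factor

  rw-large : # inA * # outA ≤ 2 ^ rw (dotGraph m) A (∁ A) * 2 ^ m
  rw-large = rank-counts cutMatrix rows columns factor inA outA (vectors-listed A) (vectors-listed (∁ A))

  open TraceCount inA outA using (Represents)
  open Tuples inA using (AllIn; orth)

  -- The complement of a trace on the far side of the cut. Orthogonality describes the vertices that
  -- a neighbourhood misses, so the counting applies to these complements.
  isolated : Subset (pow m) → Vec Bool m → Bool
  isolated t b = outA b ∧ not (lookup t (vertex b))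

  chosen? : (α : List (Vec Bool m)) (i : Fin (pow m)) → Dec (Any (λ a → vertex a ≡ i) α)
  chosen? α i = Any.any? (λ a → vertex a Fin.≟ i) α

  chosen : List (Vec Bool m) → Subset (pow m)
  chosen α = tabulate (does ∘ chosen? α)

  ∈-chosen⁻ : ∀ α {i} → i ∈ chosen α → Any (λ a → vertex a ≡ i) α
  ∈-chosen⁻ α {i} i∈ = does-true (chosen? α i) (trans (sym (lookup∘tabulate _ i)) (∈⇒lookup i∈))

  ∈-chosen⁺ : ∀ α {a} → a ∈ₗ α → vertex a ∈ chosen α
  ∈-chosen⁺ α {a} a∈ = lookup⇒∈ (trans (lookup∘tabulate _ (vertex a))
    (dec-true (chosen? α (vertex a)) (Any.map (cong vertex ∘ sym) a∈)))

  chosen⊆A : ∀ {α} → AllIn α → chosen α ⊆ A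
  chosen⊆A {α} α⊆A {i} i∈ = go α⊆A (∈-chosen⁻ α i∈)
    where
    go : ∀ {α} → AllIn α → Any (λ a → vertex a ≡ i) α → i ∈ A
    go (a∈ ∷ _)  (here refl) = lookup⇒∈ a∈
    go (_ ∷ α⊆A) (there i∈)  = go α⊆A i∈

  -- Adjacency across the cut is scalar product 1, so `b` is missed by the neighbourhood exactly if
  -- it is orthogonal to all of `α`. That `N` leaves out the chosen vertices has no effect beyond
  -- the cut.
  isolated-chosen : ∀ {α} → AllIn α → ∀ b → isolated (N (chosen α) ∩ ∁ A) b ≡ outA b ∧ orth α b
  isolated-chosen {α} α⊆A b with outA b in out
  ... | false = refl
  ... | true = trans (cong not lookup-N) (orthogonal (orth α b) refl)
    where
    i = vertex b
    i∈∁A : i ∈ ∁ A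
    i∈∁A = lookup⇒∈ out

    X = chosen α

    hit? : Dec (¬ (i ∈ X) × ∃[ u ] u ∈ X × adj u i ≡ true)
    hit? = ¬? (i ∈? X) ×-dec any? (λ u → u ∈? X ×-dec adj u i Bool.≟ true)

    lookup-N : lookup (N X ∩ ∁ A) i ≡ does hit?
    lookup-N = trans (lookup-zipWith _∧_ i (N X) (∁ A))
      (trans (cong₂ _∧_ (lookup∘tabulate _ i) out) (∧-identityʳ _))

    adj-vertex : ∀ {a} → a ∈ₗ α → adj (vertex a) i ≡ dot a b
    adj-vertex {a} a∈ = trans (adj≡dot (chosen⊆A α⊆A (∈-chosen⁺ α a∈)) i∈∁A)
      (cong₂ dot (vector-vertex a) (vector-vertex b))

    orthogonal : ∀ o → orth α b ≡ o → not (does hit?) ≡ o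
    orthogonal true eq = cong not (dec-false hit? λ (_ , u , u∈ , ui) →
      none (∈-chosen⁻ α u∈) (all-elim _ α eq) adj-vertex ui)
      where
      none : ∀ {u β} → Any (λ a → vertex a ≡ u) β → All (λ a → not (dot a b) ≡ true) β →
             (∀ {a} → a ∈ₗ β → adj (vertex a) i ≡ dot a b) → ¬ adj u i ≡ true
      none (here refl) (a⊥b ∷ _) adj≡ ui =
        contradiction (trans (sym a⊥b) (cong not (trans (sym (adj≡ (here refl))) ui))) λ ()
      none (there u∈)  (_ ∷ α⊥b) adj≡ ui = none u∈ α⊥b (adj≡ ∘ there) ui
    orthogonal false eq with all-false _ α eq
    ... | a , a∈ , ab = cong not (dec-true hit?
      ( (λ i∈X → x∈∁p⇒x∉p i∈∁A (chosen⊆A α⊆A i∈X))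
      , vertex a , ∈-chosen⁺ α a∈ , trans (adj-vertex a∈) (not-injective ab)))

  traceSets : List (Vec Bool m → Bool)
  traceSets = List.map isolated (traces (dotGraph m) A (∁ A))

  represented : ∀ α → AllIn α → Any (Represents α) traceSets
  represented α α⊆A = Any.map (λ { refl → isolated-chosen α⊆A })
    (∈-map⁺ isolated (∈-deduplicate⁺ (≡-dec Bool._≟_)
      (∈-map⁺ (λ X → N X ∩ ∁ A) (∈-filter⁺ (_⊆? A) (∈-subsets (chosen α)) (chosen⊆A α⊆A)))))

  module Balanced (A-large : pow m ≤ 3 * ∣ A ∣) (A-small : 3 * ∣ A ∣ ≤ 2 * pow m) where

    inA-large : 2 ^ m ≤ 3 * # inA
    inA-large = subst₂ (λ x y → x ≤ 3 * y) (pow≡2^ m) (∣∣≡#vectorsIn {m} A) A-large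

    outA-large : 2 ^ m ≤ 3 * # outA
    outA-large = subst₂ (λ x y → x ≤ 3 * y) (pow≡2^ m) (∣∣≡#vectorsIn {m} (∁ A)) (+-cancelʳ-≤ (2 * pow m) _ _ (begin
      pow m + 2 * pow m                  ≡⟨ cong (3 *_) (m∸n+n≡m (∣p∣≤n A)) ⟨
      3 * (pow m ∸ ∣ A ∣ + ∣ A ∣)  ≡⟨ cong (λ x → 3 * (x + ∣ A ∣)) (∣∁p∣≡n∸∣p∣ A) ⟨
      3 * (∣ ∁ A ∣ + ∣ A ∣)              ≡⟨ *-distribˡ-+ 3 ∣ ∁ A ∣ ∣ A ∣ ⟩
      3 * ∣ ∁ A ∣ + 3 * ∣ A ∣            ≤⟨ +-monoʳ-≤ (3 * ∣ ∁ A ∣) A-small ⟩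
      3 * ∣ ∁ A ∣ + 2 * pow m            ∎))
      where open ≤-Reasoning

    m≤rw+4 : m ≤ rw (dotGraph m) A (∁ A) + 4
    m≤rw+4 = ≮⇒≥ λ rw+4<m → <⇒≱ (^-monoʳ-< 2 (s≤s (s≤s z≤n)) rw+4<m) 2^m≤
      where
      open ≤-Reasoning
      R = 2 ^ rw (dotGraph m) A (∁ A)
      regroup : ∀ x y → 3 * x * (3 * y) ≡ 9 * (x * y)
      regroup = solve-∀
      regroup′ : ∀ x y → 16 * (x * y) ≡ x * 16 * y
      regroup′ = solve-∀
      2^m≤ : 2 ^ m ≤ 2 ^ (rw (dotGraph m) A (∁ A) + 4)
      2^m≤ = *-cancelʳ-≤ (2 ^ m) (2 ^ (rw (dotGraph m) A (∁ A) + 4)) (2 ^ m) {{m^n≢0 2 m}} (begin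
        2 ^ m * 2 ^ m              ≤⟨ *-mono-≤ inA-large outA-large ⟩
        3 * # inA * (3 * # outA)   ≡⟨ regroup (# inA) (# outA) ⟩
        -- The factor 9 lost to the two thirds of balance is rounded up to `2 ^ 4`, the source of
        -- the 4.
        9 * (# inA * # outA)       ≤⟨ *-mono-≤ (m≤m+n 9 7) rw-large ⟩
        16 * (R * 2 ^ m)           ≡⟨ regroup′ R (2 ^ m) ⟩
        R * 16 * 2 ^ m             ≡⟨ cong (_* 2 ^ m) (^-distribˡ-+-* 2 (rw (dotGraph m) A (∁ A)) 4) ⟨
        2 ^ (rw (dotGraph m) A (∁ A) + 4) * 2 ^ m ∎)

bw-large : ∀ r (A : Subset (pow (dim r))) → pow (dim r) ≤ 3 * ∣ A ∣ → 3 * ∣ A ∣ ≤ 2 * pow (dim r) →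
  2 ^ (suc r * suc r) ≤ Log₂.argument (bw (dotGraph (dim r)) A (∁ A))
bw-large r A A-large A-small = subst (2 ^ (suc r * suc r) ≤_) (length-map isolated (traces (dotGraph (dim r)) A (∁ A)))
  (many-traces r inA outA traceSets inA-large outA-large represented)
  where
  open Cut {dim r} A
  open Balanced A-large A-small

-- From cuts to the two widths

≤log-power : ∀ {a e M} b → a ≤ e * suc b → 2 ^ e ≤ M → 2 ^ a ≤ M ^ suc b
≤log-power {a} {e} {M} b a≤ 2^e≤ = begin
  2 ^ a            ≤⟨ ^-monoʳ-≤ 2 a≤ ⟩
  2 ^ (e * suc b)  ≡⟨ ^-*-assoc 2 e (suc b) ⟨
  (2 ^ e) ^ suc b  ≤⟨ ^-monoˡ-≤ (suc b) 2^e≤ ⟩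
  M ^ suc b        ∎
  where open ≤-Reasoning

*-≤log : ∀ {a e} d β → a ≤ e * suc d → 2 ^ e ≤ Log₂.argument β → (mkℚᵘ (ℤ.+ 1) d ℚᵘ.* (ℤ.+ a ℚᵘ./ 1)) ≤log β
*-≤log {a} {e} d β a≤ 2^e≤ =
  subst (_≤log β) (cong₂ mkℚᵘ (sym numerator) (sym (*-identityʳ d))) (≤log-power {a} {e} d a≤ 2^e≤)
  where
  numerator : ℤ.+ 1 ℤ.* ℤ.+ a ≡ ℤ.+ a
  numerator = ℤ.*-identityˡ (ℤ.+ a)

3≤pow : ∀ r → 3 ≤ pow (dim r)
3≤pow r = begin
  3            ≤⟨ m≤m+n 3 1 ⟩
  2 ^ 2        ≤⟨ ^-monoʳ-≤ 2 (≤-trans (m≤m+n 2 3) (m≤n+m 5 (20 * r + 15))) ⟩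
  2 ^ dim r    ≡⟨ pow≡2^ (dim r) ⟨
  pow (dim r)  ∎
  where open ≤-Reasoning

rankWidth≤ : ∀ {k} → RankWidth (dotGraph m) k → k ≤ m
rankWidth≤ {m} ((_ , (A , _ , rw≡k) , _) , _) = ≤-trans (≤-reflexive (sym rw≡k)) (Cut.rw≤m {m} A)

-- Far below the `dim r - 4` that the balanced cut provides, but enough to make `k` arbitrarily
-- large.
rankWidth≥ : ∀ r {k} → RankWidth (dotGraph (dim r)) k → r ≤ k
rankWidth≥ r {k} rankWidth with Width.balanced-cut id (3≤pow r) (λ A → rw (dotGraph (dim r)) A (∁ A)) rankWidth
... | A , A-large , A-small , rw≤k = +-cancelʳ-≤ 4 r k (begin
  r + 4                                ≤⟨ +-mono-≤ (≤-trans (m≤m+n r _) (m≤m+n (20 * r) 15)) (m≤m+n 4 1) ⟩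
  dim r                                ≤⟨ Cut.Balanced.m≤rw+4 {dim r} A A-large A-small ⟩
  rw (dotGraph (dim r)) A (∁ A) + 4    ≤⟨ +-monoˡ-≤ 4 rw≤k ⟩
  k + 4                                ∎)
  where open ≤-Reasoning

booleanWidth≥ : ∀ r {β} → BooleanWidth (dotGraph (dim r)) β → 2 ^ (suc r * suc r) ≤ Log₂.argument β
booleanWidth≥ r booleanWidth
  with Width.balanced-cut Log₂.argument (3≤pow r) (λ A → bw (dotGraph (dim r)) A (∁ A)) booleanWidth
... | A , A-large , A-small , bw≤β = ≤-trans (bw-large r A A-large A-small) bw≤β

dim≡ : ∀ r → dim r ≡ suc r * 20
dim≡ = expanded
  where
  expanded : ∀ r → 20 * r + 15 + 5 ≡ suc r * 20
  expanded = solve-∀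

-- From `k ≤ 20 s` follows `k² / 400 ≤ s²`. Denominators are stored less one, hence 399.
square-≤log : ∀ {k m s} β → k ≤ m → m ≡ s * 20 → 2 ^ (s * s) ≤ Log₂.argument β →
              (mkℚᵘ (ℤ.+ 1) 399 ℚᵘ.* (ℤ.+ (k ^ 2) ℚᵘ./ 1)) ≤log β
square-≤log {k} {m} {s} β k≤m refl = *-≤log {k ^ 2} {s * s} 399 β (begin
  k ^ 2            ≤⟨ ^-monoˡ-≤ 2 k≤m ⟩
  (s * 20) ^ 2     ≡⟨ square s 20 ⟩
  s * s * 400      ∎)
  where
  open ≤-Reasoning
  square : ∀ s d → s * d * (s * d * 1) ≡ s * s * (d * d)
  square = solve-∀

witness : ∀ r →
  ∃ (RankWidth (dotGraph (dim r))) → ∃ (BooleanWidth (dotGraph (dim r))) →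
  Σ[ k ∈ ℕ ] r ≤ k ×
  (Σ[ n ∈ ℕ ] Σ[ G ∈ Graph n ] 3 ≤ n × RankWidth G k ×
    (Σ[ β ∈ Log₂ ] BooleanWidth G β × (mkℚᵘ (ℤ.+ 1) 399 ℚᵘ.* (ℤ.+ (k ^ 2) ℚᵘ./ 1)) ≤log β))
witness r (k , rankWidth) (β , booleanWidth) =
  k , rankWidth≥ r rankWidth , pow (dim r) , dotGraph (dim r) , 3≤pow r , rankWidth , β , booleanWidth ,
  square-≤log {m = dim r} {s = suc r} β (rankWidth≤ rankWidth) (dim≡ r) (booleanWidth≥ r booleanWidth)

theorem1p3 :
    Σ[ c ∈ ℚᵘ ] 0ℚᵘ ℚᵘ.< c ×
      (∀ (k₀ : ℕ) →
        Σ[ k ∈ ℕ ] k₀ ≤ k ×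
        (Σ[ n ∈ ℕ ] Σ[ G ∈ Graph n ] 3 ≤ n × RankWidth G k ×
          (Σ[ β ∈ Log₂ ] BooleanWidth G β × (c ℚᵘ.* (ℤ.+ (k ^ 2) ℚᵘ./ 1)) ≤log β)))
-- The constant is 1 / 400, and `k₀` itself can be the parameter `r`, since the rank-width is at
-- least `r`.
theorem1p3 = mkℚᵘ (ℤ.+ 1) 399 , *<* (ℤ.+<+ (s≤s z≤n)) , λ k₀ → witness k₀
  (Width.branchWidth-exists id (3≤pow k₀) (λ A → rw (dotGraph (dim k₀)) A (∁ A)))
  (Width.branchWidth-exists Log₂.argument (3≤pow k₀) (λ A → bw (dotGraph (dim k₀)) A (∁ A)))
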